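{- Let $n\ge1$. (1) For $0\le j\le n$ such that the polynomial $\sum_{\pi\in C_l\wr\mathfrak{S}_n,\ \mathrm{fix}(\pi)=j}t^{\mathrm{fexc}(\pi)}q^{(\mathrm{maj}-\mathrm{exc})\pi}$ is nonzero, it is $t$-symmetric and $t$-unimodal with center of symmetry $\frac{l(n-j)}{2}$; (2) the polynomial $A_n^{(l)}(t,q)=\sum_{\pi\in C_l\wr\mathfrak{S}_n}t^{\mathrm{fexc}(\pi)}q^{(\mathrm{maj}-\mathrm{exc})\pi}$ is $t$-symmetric and $t$-unimodal with center of symmetry $\frac{ln-1}{2}$. Here coefficients in $\mathbb Q[q]$ are ordered by $f\le_q g$ iff $g-f$ has nonnegative coefficients.
   Context: Fix $l\ge1$. The colored permutation group $C_l\wr\mathfrak{S}_n$ is the set of words $\pi=\pi_1\cdots\pi_n$ with letters $\pi_i=|\pi_i|^{\epsilon_i}$, $\epsilon_i\in\{0,\dots,l-1\}$, such that $|\pi_1|\cdots|\pi_n|$ is a permutation of $[n]$. Use the color order $1^{l-1}<2^{l-1}<\cdots<n^{l-1}<1^{l-2}<\cdots<n^{l-2}<\cdots<1^0<2^0<\cdots<n^0$. Then $\mathrm{DES}(\pi)=\{j\in[n-1]:\pi_j>\pi_{j+1}\}$, $\mathrm{maj}(\pi)=\sum_{j\in\mathrm{DES}(\pi)}j$, $\mathrm{exc}(\pi)=|\{j\in[n]:\pi_j>j^0\}|$, $\mathrm{fexc}(\pi)=l\cdot\mathrm{exc}(\pi)+\sum_{i=1}^n\epsilon_i$, $\mathrm{fix}(\pi)=|\{j:\pi_j=j^0\}|$.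 A nonzero polynomial $a_rt^r+\dots+a_st^s$ ($a_r,a_s\neq0$) is $t$-symmetric with center $\frac{r+s}{2}$ if $a_{r+i}=a_{s-i}$ for all $i$, and $t$-unimodal if $a_r\le a_{r+1}\le\dots\le a_{\lfloor(r+s)/2\rfloor}=a_{\lfloor(r+s+1)/2\rfloor}\ge\dots\ge a_s$. -}

module Defs where

open import Data.Nat using (ℕ; zero; suc; _+_; _*_; _∸_; _≤_; _<_; _/_; _≡ᵇ_; _<ᵇ_)
open import Data.Bool using (Bool; true; false; if_then_else_; _∧_; _∨_)
open import Data.Fin using (Fin; toℕ)
open import Data.List using (List; []; _∷_; [_]; map; concatMap; cartesianProduct; allFin; filterᵇ; length)
open import Data.Vec using (Vec; toList) renaming ([] to []ᵥ; _∷_ to _∷ᵥ_)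
open import Data.Product using (_×_; _,_; proj₁; proj₂; ∃-syntax)
open import Data.Integer using (ℤ; _⊖_)
import Data.Integer.Properties as ℤP
open import Relation.Nullary using (¬_)
open import Relation.Nullary.Decidable using (⌊_⌋)
open import Relation.Binary.PropositionalEquality using (_≡_)

-- A letter |π_i|^{ε_i} of a colored permutation in C_l ≀ S_n is encoded as
-- (v , e) : Fin n × Fin l, meaning the value v+1 with color e.
Letter : ℕ → ℕ → Set
Letter n l = Fin n × Fin l

letters : (n l : ℕ) → List (Letter n l)
letters n l = cartesianProduct (allFin n) (allFin l)

words : (n l k : ℕ) → List (Vec (Letter n l) k)
words n l zero = [ []ᵥ ]
words n l (suc k) = concatMap (λ a → map (a ∷ᵥ_) (words n l k)) (letters n l)

memᵇ : ℕ → List ℕ → Bool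
memᵇ x [] = false
memᵇ x (y ∷ ys) = (x ≡ᵇ y) ∨ memᵇ x ys

distinctᵇ : List ℕ → Bool
distinctᵇ [] = true
distinctᵇ (x ∷ xs) = if memᵇ x xs then false else distinctᵇ xs

isColPerm : {n l : ℕ} → Vec (Letter n l) n → Bool
isColPerm w = distinctᵇ (map (λ a → toℕ (proj₁ a)) (toList w))

ColPerms : (l n : ℕ) → List (Vec (Letter n l) n)
ColPerms l n = filterᵇ isColPerm (words n l n)

-- Position of a letter in the total color order
-- 1^{l-1} < ... < n^{l-1} < 1^{l-2} < ... < n^{l-2} < ... < 1^0 < ... < n^0
key : {n l : ℕ} → Letter n l → ℕ
key {n} {l} (v , e) = (l ∸ 1 ∸ toℕ e) * n + toℕ v

-- sum of positions p (1-based, p = position of the head) of descents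
desSum : {n l : ℕ} → ℕ → List (Letter n l) → ℕ
desSum p [] = 0
desSum p (a ∷ []) = 0
desSum p (a ∷ b ∷ rest) = (if key b <ᵇ key a then p else 0) + desSum (suc p) (b ∷ rest)

maj : {n l : ℕ} → Vec (Letter n l) n → ℕ
maj w = desSum 1 (toList w)

-- p is the 0-based position; π_{p+1} > (p+1)^0 iff key π_{p+1} > key (p+1)^0
excAux : {n l : ℕ} → ℕ → List (Letter n l) → ℕ
excAux p [] = 0
excAux {n} {l} p (a ∷ rest) = (if ((l ∸ 1) * n + p) <ᵇ key a then 1 else 0) + excAux {n} {l} (suc p) rest

exc : {n l : ℕ} → Vec (Letter n l) n → ℕ
exc w = excAux 0 (toList w)

fixAux : {n l : ℕ} → ℕ → List (Letter n l) → ℕ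
fixAux p [] = 0
fixAux p ((v , e) ∷ rest) = (if (toℕ v ≡ᵇ p) ∧ (toℕ e ≡ᵇ 0) then 1 else 0) + fixAux (suc p) rest

fix : {n l : ℕ} → Vec (Letter n l) n → ℕ
fix w = fixAux 0 (toList w)

colorSum : {n l : ℕ} → List (Letter n l) → ℕ
colorSum [] = 0
colorSum ((v , e) ∷ rest) = toℕ e + colorSum rest

fexc : {n l : ℕ} → Vec (Letter n l) n → ℕ
fexc {n} {l} w = l * exc w + colorSum (toList w)

majMinusExc : {n l : ℕ} → Vec (Letter n l) n → ℤ
majMinusExc w = maj w ⊖ exc w

-- A polynomial in t whose coefficients are (Laurent) polynomials in q with
-- natural-number coefficients: P k m = coefficient of t^k q^m.
TQPoly : Set
TQPoly = ℕ → ℤ → ℕ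

_≈q_ : (ℤ → ℕ) → (ℤ → ℕ) → Set
f ≈q g = ∀ m → f m ≡ g m

_≤q_ : (ℤ → ℕ) → (ℤ → ℕ) → Set
f ≤q g = ∀ m → f m ≤ g m

NonZeroQ : (ℤ → ℕ) → Set
NonZeroQ f = ∃[ m ] ¬ (f m ≡ 0)

NonZeroT : TQPoly → Set
NonZeroT P = ∃[ k ] NonZeroQ (P k)

Support : TQPoly → ℕ → ℕ → Set
Support P r s = NonZeroQ (P r) × NonZeroQ (P s)
              × (∀ k → k < r → P k ≈q (λ _ → 0))
              × (∀ k → s < k → P k ≈q (λ _ → 0))

-- t-symmetric with center c2/2 (c2 = twice the center = r + s)
TSymmetricCenter : TQPoly → ℕ → Set
TSymmetricCenter P c2 = ∃[ r ] ∃[ s ] (Support P r s × (r + s ≡ c2)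
                        × (∀ i → i ≤ s ∸ r → P (r + i) ≈q P (s ∸ i)))

TUnimodal : TQPoly → Set
TUnimodal P = ∃[ r ] ∃[ s ] (Support P r s
              × (∀ k → r ≤ k → suc k ≤ (r + s) / 2 → P k ≤q P (suc k))
              × (P ((r + s) / 2) ≈q P (suc (r + s) / 2))
              × (∀ k → suc (r + s) / 2 ≤ k → suc k ≤ s → P (suc k) ≤q P k))

count : {A : Set} → (A → Bool) → List A → ℕ
count p xs = length (filterᵇ p xs)

fixPoly : (l n j : ℕ) → TQPoly
fixPoly l n j k m = count (λ π → (fix π ≡ᵇ j) ∧ (fexc π ≡ᵇ k) ∧ ⌊ majMinusExc π ℤP.≟ m ⌋) (ColPerms l n)

APoly : (l n : ℕ) → TQPoly
APoly l n k m = count (λ π → (fexc π ≡ᵇ k) ∧ ⌊ majMinusExc π ℤP.≟ m ⌋) (ColPerms l n)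

{-# OPTIONS --safe #-}
module Submission where

-- Let dex = maj - exc. Give excedances the rank 0, letters of colour e > 0 the rank l - e and the
-- remaining letters the rank l; then dex is the sum of the descents of a word whose letters are
-- ordered by rank and then by value. In this order a fixed point of colour 0 behaves as a letter
-- larger than all others, so that inserting j fixed points into a coloured permutation δ of size k
-- without fixed points produces the factor [k+j choose j]_q: the sum of q^dex is q^(dex δ) times it.
-- If fixed points are counted as excedances, they have rank 0 and weight t^l and behave as smallest
-- letters, with the same q-factor. The two conventions are exchanged by the predecessor map of the
-- order by rank and value (rotation of the values), which preserves descents and multiplies by t.
-- With D_k the generating function of coloured permutations without fixed points, this gives
--   t Σ [n choose k]_q D_k = Σ [n choose k]_q t^(l(n-k)) D_k   for n ≥ 1,
-- that is, D_n = Σ_{k<n} [n choose k]_q (t + ⋯ + t^(l(n-k)-1)) D_k, and in turn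
-- A_n = Σ_{k<n} [n choose k]_q (1 + ⋯ + t^(l(n-k)-1)) D_k. Multiplication by a block of consecutive
-- powers of t preserves symmetry and unimodality, and all centres match.

open import Defs
open import Data.Nat
open import Data.Nat.Properties
open import Algebra.Properties.CommutativeSemigroup +-commutativeSemigroup using (interchange; x∙yz≈y∙xz; xy∙z≈y∙xz)
open import Data.Bool using (Bool; true; false; if_then_else_; not; _∧_; _∨_; T)
open import Data.Bool.Properties using (T-≡; ∧-assoc; ∧-zeroʳ; ∧-identityʳ; ∨-zeroʳ)
open import Data.Empty using (⊥; ⊥-elim)
open import Data.Fin using (toℕ; fromℕ<)
open import Data.Fin.Properties using (toℕ-injective; toℕ<n; toℕ-fromℕ<)
open import Data.Integer as ℤ using (ℤ; _⊖_)
import Data.Integer.Properties as ℤP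
open import Data.List using (List; []; _∷_; _++_; _ʳ++_; map; concatMap; filter; filterᵇ; length; reverse; upTo; applyUpTo)
open import Data.List.Membership.Propositional using (_∈_; _∉_; find; lose)
open import Data.List.Membership.Propositional.Properties using (∈-++⁻; ∈-++⁺ˡ; ∈-++⁺ʳ; ∈-map⁻; ∈-map⁺; ∈-concatMap⁺; ∈-concatMap⁻; ∈-filter⁺; ∈-filter⁻; ∈-cartesianProduct⁺; ∈-allFin; ∈-upTo⁺; ∈-∃++)
open import Data.List.Properties using (length-map; map-∘; map-id; map-++; map-cong; map-injective; ∷-injective; ∷-injectiveʳ; length-upTo; length-reverse; reverse-injective; reverse-involutive)
open import Data.List.Relation.Binary.Permutation.Propositional using (_↭_; refl; prep; swap; ↭-sym; ↭-trans; ↭⇒↭ₛ)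
import Data.List.Relation.Binary.Permutation.Propositional.Properties as Perm
import Data.List.Relation.Binary.Permutation.Setoid.Properties as Permₛ
open import Data.List.Relation.Binary.Subset.Propositional using (_⊆_)
open import Data.List.Relation.Unary.All as All using (All; []; _∷_)
import Data.List.Relation.Unary.All.Properties as AllP
open import Data.List.Relation.Unary.AllPairs using ([]; _∷_)
open import Data.List.Relation.Unary.Any using (here; there)
open import Data.List.Relation.Unary.Unique.Propositional using (Unique)
import Data.List.Relation.Unary.Unique.Propositional.Properties as Uniq
open import Data.Maybe as Maybe using (Maybe; just; nothing)
open import Data.Nat.DivMod using (/-monoˡ-≤; +-distrib-/-∣ˡ)
open import Data.Nat.Divisibility using (divides)
open import Data.Nat.Induction using (<-rec)
open import Data.Nat.Tactic.RingSolver using (solve-∀)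
open import Data.Product using (_×_; _,_; ∃; proj₁; proj₂)
open import Data.Sum using (_⊎_; inj₁; inj₂)
open import Data.Vec as Vec using (Vec; toList) renaming ([] to []ᵥ; _∷_ to _∷ᵥ_)
open import Function using (_∘_; id; Equivalence)
open import Relation.Binary.Definitions using (tri<; tri≈; tri>)
open import Relation.Binary.PropositionalEquality hiding ([_])
open import Relation.Nullary using (¬_; Dec; yes; no; contradiction)
open import Relation.Nullary.Decidable using (⌊_⌋; T?; map′; dec-true; isYes≗does)

-- Finite sums

-- Why the ranks absorb `exc`: consider a maximal run of excedances at consecutive positions a, ...,
-- b. In the colour order these letters exceed their neighbours outside the run, so there is a
-- descent at b and none at a - 1; once they have rank 0 it is the other way round. The sum of
-- descents drops by b - (a - 1), the length of the run. The power of t is visible in the same word,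
-- since l - rank is the share of a letter in `fexc`. Why two conventions for fixed points: with the
-- code rank * n + value, the predecessor map subtracts 1 from every code. An excedance of value v +
-- 1 > p at position p becomes a letter of value v ≥ p, so excedances turn into weak excedances and
-- fixed points have to be counted among them. Exactly one letter, that of least value, changes its
-- rank, which accounts for the single factor t. Division: the rotation identity says (1 - t) D_n =
-- Σ_{k<n} [n choose k]_q (t - t^(l(n-k))) D_k. Over ℕ the negative terms are moved across, and the
-- factor 1 - t is cancelled by induction on the degree in t.

𝟙 : Bool → ℕ
𝟙 b = if b then 1 else 0

module _ {A : Set} where

  ∑ : List A → (A → ℕ) → ℕ
  ∑ [] f = 0
  ∑ (x ∷ xs) f = f x + ∑ xs f

  ∑-cong∈ : ∀ xs {f g : A → ℕ} → (∀ {x} → x ∈ xs → f x ≡ g x) → ∑ xs f ≡ ∑ xs g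
  ∑-cong∈ [] h = refl
  ∑-cong∈ (x ∷ xs) h = cong₂ _+_ (h (here refl)) (∑-cong∈ xs (h ∘ there))

  ∑-cong : ∀ xs {f g : A → ℕ} → (∀ x → f x ≡ g x) → ∑ xs f ≡ ∑ xs g
  ∑-cong xs h = ∑-cong∈ xs (λ {x} _ → h x)

  ∑-++ : ∀ xs ys {f : A → ℕ} → ∑ (xs ++ ys) f ≡ ∑ xs f + ∑ ys f
  ∑-++ [] ys = refl
  ∑-++ (x ∷ xs) ys {f} = trans (cong (f x +_) (∑-++ xs ys)) (sym (+-assoc (f x) _ _))

  ∑-+ : ∀ xs {f g : A → ℕ} → ∑ xs (λ x → f x + g x) ≡ ∑ xs f + ∑ xs g
  ∑-+ [] = refl
  ∑-+ (x ∷ xs) {f} {g} = trans (cong (f x + g x +_) (∑-+ xs)) (interchange (f x) (g x) _ _)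

  ∑-zero : ∀ xs → ∑ xs (λ _ → 0) ≡ 0
  ∑-zero [] = refl
  ∑-zero (_ ∷ xs) = ∑-zero xs

  ∑-↭ : ∀ {xs ys} {f : A → ℕ} → xs ↭ ys → ∑ xs f ≡ ∑ ys f
  ∑-↭ refl = refl
  ∑-↭ {f = f} (prep x p) = cong (f x +_) (∑-↭ p)
  ∑-↭ {f = f} (swap x y p) = trans (x∙yz≈y∙xz (f x) (f y) _) (cong (λ s → f y + (f x + s)) (∑-↭ p))
  ∑-↭ {f = f} (_↭_.trans p q) = trans (∑-↭ {f = f} p) (∑-↭ q)

  length-filterᵇ : ∀ (p : A → Bool) xs → length (filterᵇ p xs) ≡ ∑ xs (𝟙 ∘ p)
  length-filterᵇ p [] = refl
  length-filterᵇ p (x ∷ xs) with p x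
  ... | true = cong suc (length-filterᵇ p xs)
  ... | false = length-filterᵇ p xs

∑-map : ∀ {A B : Set} (g : A → B) xs {f : B → ℕ} → ∑ (map g xs) f ≡ ∑ xs (f ∘ g)
∑-map g [] = refl
∑-map g (x ∷ xs) = cong (_ +_) (∑-map g xs)

∑-concatMap : ∀ {A B : Set} (g : A → List B) xs {f : B → ℕ} → ∑ (concatMap g xs) f ≡ ∑ xs (λ x → ∑ (g x) f)
∑-concatMap g [] = refl
∑-concatMap g (x ∷ xs) = trans (∑-++ (g x) _) (cong (_ +_) (∑-concatMap g xs))

∑-swap : ∀ {A B : Set} (xs : List A) (ys : List B) {f : A → B → ℕ} →
  ∑ xs (λ x → ∑ ys (f x)) ≡ ∑ ys (λ y → ∑ xs (λ x → f x y))
∑-swap [] ys = sym (∑-zero ys)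
∑-swap (x ∷ xs) ys = trans (cong (_ +_) (∑-swap xs ys)) (sym (∑-+ ys))

-- Duplicate-free lists as finite sets

module _ {A : Set} where

  Unique-resp-↭ : ∀ {xs ys : List A} → xs ↭ ys → Unique xs → Unique ys
  Unique-resp-↭ p = Permₛ.Unique-resp-↭ (setoid A) (↭⇒↭ₛ p)

  ∈⇒↭∷ : ∀ {x : A} {xs} → x ∈ xs → ∃ λ ys → xs ↭ x ∷ ys
  ∈⇒↭∷ {x} p with us , vs , refl ← ∈-∃++ p = us ++ vs , Perm.shift x us vs

  ⊆-tail : ∀ {x : A} {xs ys zs} → Unique (x ∷ xs) → x ∷ xs ⊆ ys → ys ↭ x ∷ zs → xs ⊆ zs
  ⊆-tail u s p y∈xs with Perm.∈-resp-↭ p (s (there y∈xs))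
  ... | here refl = ⊥-elim (Uniq.Unique[x∷xs]⇒x∉xs u y∈xs)
  ... | there y∈zs = y∈zs

  unique-⊆⇒≤ : ∀ {xs ys : List A} → Unique xs → xs ⊆ ys → length xs ≤ length ys
  unique-⊆⇒≤ {[]} _ _ = z≤n
  unique-⊆⇒≤ {x ∷ xs} u@(_ ∷ u′) s with zs , p ← ∈⇒↭∷ (s (here refl)) =
    subst (suc (length xs) ≤_) (sym (Perm.↭-length p)) (s≤s (unique-⊆⇒≤ u′ (⊆-tail u s p)))

  -- The pigeonhole principle: an injective self-map of a finite set is bijective, so the rotation
  -- never needs an explicit inverse.
  unique-⊆⇒↭ : ∀ {xs ys : List A} → Unique xs → xs ⊆ ys → length ys ≤ length xs → xs ↭ ys
  unique-⊆⇒↭ {[]} {[]} _ _ _ = refl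
  unique-⊆⇒↭ {x ∷ xs} u@(_ ∷ u′) s le with zs , p ← ∈⇒↭∷ (s (here refl)) =
    ↭-trans (prep x (unique-⊆⇒↭ u′ (⊆-tail u s p) (s≤s⁻¹ (subst (_≤ _) (Perm.↭-length p) le)))) (↭-sym p)

  unique-⊆⊇⇒↭ : ∀ {xs ys : List A} → Unique xs → Unique ys → xs ⊆ ys → ys ⊆ xs → xs ↭ ys
  unique-⊆⊇⇒↭ ux uy s t = unique-⊆⇒↭ ux s (unique-⊆⇒≤ uy t)

-- Gaussian binomials and the major index of shuffles

-- gauss k j lists the exponents of q in the Gaussian binomial [k+j choose j].
gauss : ℕ → ℕ → List ℕ
gauss zero j = 0 ∷ []
gauss (suc k) zero = 0 ∷ []
gauss (suc k) (suc j) = gauss (suc k) j ++ map (suc j +_) (gauss k (suc j))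

∑-gauss-0ʳ : ∀ k {ψ : ℕ → ℕ} → ∑ (gauss k 0) ψ ≡ ψ 0
∑-gauss-0ʳ zero = +-identityʳ _
∑-gauss-0ʳ (suc k) = +-identityʳ _

∑-gauss : ∀ k j (ψ : ℕ → ℕ) → ∑ (gauss (suc k) (suc j)) ψ
  ≡ ∑ (gauss (suc k) j) ψ + ∑ (gauss k (suc j)) (ψ ∘ (suc j +_))
∑-gauss k j ψ = trans (∑-++ (gauss (suc k) j) _) (cong (∑ (gauss (suc k) j) ψ +_) (∑-map (suc j +_) (gauss k (suc j))))

-- The second q-Pascal rule, with the roles of k and j exchanged. In the shuffle lemmas a descent
-- between the last two letters of the given word calls for the first rule and an ascent for this
-- one.
∑-gauss′ : ∀ k j (ψ : ℕ → ℕ) → ∑ (gauss (suc k) (suc j)) ψ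
  ≡ ∑ (gauss k (suc j)) ψ + ∑ (gauss (suc k) j) (ψ ∘ (suc k +_))
∑-gauss′ zero zero ψ = sym (cong₂ _+_ (+-identityʳ (ψ 0)) refl)
∑-gauss′ zero (suc j) ψ = begin
  ∑ (gauss 1 (suc (suc j))) ψ
    ≡⟨ ∑-gauss 0 (suc j) ψ ⟩
  ∑ (gauss 1 (suc j)) ψ + (ψ (suc (suc j) + 0) + 0)
    ≡⟨ cong₂ _+_ (∑-gauss′ zero j ψ) refl ⟩
  ψ 0 + 0 + ∑ (gauss 1 j) (ψ ∘ suc) + (ψ (suc (suc j) + 0) + 0)
    ≡⟨ +-assoc (ψ 0 + 0) _ _ ⟩
  ψ 0 + 0 + (∑ (gauss 1 j) (ψ ∘ suc) + (ψ (suc (suc j) + 0) + 0))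
    ≡⟨ cong (ψ 0 + 0 +_) (∑-gauss 0 j (ψ ∘ suc)) ⟨
  ψ 0 + 0 + ∑ (gauss 1 (suc j)) (ψ ∘ suc) ∎
  where open ≡-Reasoning
∑-gauss′ (suc k) zero ψ = begin
  ∑ (gauss (2 + k) 1) ψ
    ≡⟨ ∑-gauss (suc k) 0 ψ ⟩
  ψ 0 + 0 + ∑ (gauss (suc k) 1) (ψ ∘ suc)
    ≡⟨ cong (ψ 0 + 0 +_) (∑-gauss′ k 0 (ψ ∘ suc)) ⟩
  ψ 0 + 0 + (∑ (gauss k 1) (ψ ∘ suc) + (ψ (suc (suc k) + 0) + 0))
    ≡⟨ +-assoc (ψ 0 + 0) _ _ ⟨
  ψ 0 + 0 + ∑ (gauss k 1) (ψ ∘ suc) + (ψ (suc (suc k) + 0) + 0)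
    ≡⟨ cong₂ _+_ (∑-gauss k 0 ψ) refl ⟨
  ∑ (gauss (suc k) 1) ψ + (ψ (suc (suc k) + 0) + 0) ∎
  where open ≡-Reasoning
∑-gauss′ (suc k) (suc j) ψ = begin
  ∑ (gauss (2 + k) (2 + j)) ψ
    ≡⟨ ∑-gauss (suc k) (suc j) ψ ⟩
  ∑ (gauss (2 + k) (suc j)) ψ + ∑ (gauss (suc k) (2 + j)) (ψ ∘ (2 + j +_))
    ≡⟨ cong₂ _+_ (∑-gauss′ (suc k) j ψ) (∑-gauss′ k (suc j) (ψ ∘ (2 + j +_))) ⟩
  (∑ (gauss (suc k) (suc j)) ψ + ∑ (gauss (2 + k) j) (ψ ∘ (2 + k +_)))
    + (∑ (gauss k (2 + j)) (ψ ∘ (2 + j +_)) + ∑ (gauss (suc k) (suc j)) (λ c → ψ (2 + j + (suc k + c))))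
    ≡⟨ interchange (∑ (gauss (suc k) (suc j)) ψ) _ _ _ ⟩
  (∑ (gauss (suc k) (suc j)) ψ + ∑ (gauss k (2 + j)) (ψ ∘ (2 + j +_)))
    + (∑ (gauss (2 + k) j) (ψ ∘ (2 + k +_)) + ∑ (gauss (suc k) (suc j)) (λ c → ψ (2 + j + (suc k + c))))
    ≡⟨ cong₂ _+_ (sym (∑-gauss k (suc j) ψ)) (cong (∑ (gauss (2 + k) j) (ψ ∘ (2 + k +_)) +_)
         (∑-cong (gauss (suc k) (suc j)) (λ c → cong ψ (exponents j k c)))) ⟩
  ∑ (gauss (suc k) (2 + j)) ψ
    + (∑ (gauss (2 + k) j) (ψ ∘ (2 + k +_)) + ∑ (gauss (suc k) (suc j)) (λ c → ψ (2 + k + (suc j + c))))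
    ≡⟨ cong (∑ (gauss (suc k) (2 + j)) ψ +_) (∑-gauss (suc k) j (ψ ∘ (2 + k +_))) ⟨
  ∑ (gauss (suc k) (2 + j)) ψ + ∑ (gauss (2 + k) (suc j)) (ψ ∘ (2 + k +_)) ∎
  where
  open ≡-Reasoning
  exponents : ∀ j k c → 2 + j + (suc k + c) ≡ 2 + k + (suc j + c)
  exponents = solve-∀

masks : ℕ → ℕ → List (List Bool)
masks zero zero = [] ∷ []
masks zero (suc j) = map (false ∷_) (masks zero j)
masks (suc k) zero = map (true ∷_) (masks k zero)
masks (suc k) (suc j) = map (true ∷_) (masks k (suc j)) ++ map (false ∷_) (masks (suc k) j)

∑-masks : ∀ k j {f : List Bool → ℕ} → ∑ (masks (suc k) (suc j)) f
  ≡ ∑ (masks k (suc j)) (f ∘ (true ∷_)) + ∑ (masks (suc k) j) (f ∘ (false ∷_))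
∑-masks k j = trans (∑-++ (map (true ∷_) (masks k (suc j))) _)
  (cong₂ _+_ (∑-map (true ∷_) (masks k (suc j))) (∑-map (false ∷_) (masks (suc k) j)))

module _ {X : Set} where

  -- Words are written from right to left: the head of a list is the last letter,
  -- whose 0-based position is the length of the tail.
  majBy : (X → X → Bool) → List X → ℕ
  majBy gt [] = 0
  majBy gt (x ∷ []) = 0
  majBy gt (x ∷ y ∷ ys) = (if gt y x then suc (length ys) else 0) + majBy gt (y ∷ ys)

module _ {X : Set} where

  shuffle : List Bool → List X → List (Maybe X)
  shuffle [] u = []
  shuffle (false ∷ b) u = nothing ∷ shuffle b u
  shuffle (true ∷ b) [] = []
  shuffle (true ∷ b) (x ∷ u) = just x ∷ shuffle b u

  length-shuffle : ∀ u j {b} → b ∈ masks (length u) j → length (shuffle b u) ≡ length u + j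
  length-shuffle [] zero (here refl) = refl
  length-shuffle [] (suc j) p with _ , q , refl ← ∈-map⁻ (false ∷_) p = cong suc (length-shuffle [] j q)
  length-shuffle (x ∷ u) zero p with _ , q , refl ← ∈-map⁻ (true ∷_) p = cong suc (length-shuffle u zero q)
  length-shuffle (x ∷ u) (suc j) p with ∈-++⁻ (map (true ∷_) (masks (length u) (suc j))) p
  ... | inj₁ p′ with _ , q , refl ← ∈-map⁻ (true ∷_) p′ = cong suc (length-shuffle u (suc j) q)
  ... | inj₂ p′ with _ , q , refl ← ∈-map⁻ (false ∷_) p′ =
    trans (cong suc (length-shuffle (x ∷ u) j q)) (sym (+-suc (suc (length u)) j))

  -- nothing is a letter above all others for s = true and below all others for s = false.
  extend : Bool → (X → X → Bool) → Maybe X → Maybe X → Bool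
  extend s gt nothing nothing = false
  extend s gt nothing (just _) = s
  extend s gt (just _) nothing = not s
  extend s gt (just x) (just y) = gt x y

  module _ (gt : X → X → Bool) where

    maj∞ maj-∞ : List (Maybe X) → ℕ
    maj∞ = majBy (extend true gt)
    maj-∞ = majBy (extend false gt)

    maj∞-nothing∷ : ∀ w → maj∞ (nothing ∷ w) ≡ maj∞ w
    maj∞-nothing∷ [] = refl
    maj∞-nothing∷ (just _ ∷ w) = refl
    maj∞-nothing∷ (nothing ∷ w) = refl

    private
      m = majBy gt

    -- The induction removes letters from the right, so the last letter must be known before its
    -- descent can be counted; here it is `x`. The shift by `j` is visible for empty `u`: for
    -- positive `j`, the only descent of `j` maximal letters followed by `x` is at position `j`.
    ∑-maj∞-just : ∀ x u j (ψ : ℕ → ℕ) → ∑ (masks (length u) j) (λ b → ψ (maj∞ (just x ∷ shuffle b u)))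
      ≡ ∑ (gauss (length u) j) (λ c → ψ (m (x ∷ u) + j + c))
    ∑-maj∞ : ∀ u j (ψ : ℕ → ℕ) → ∑ (masks (length u) j) (λ b → ψ (maj∞ (shuffle b u)))
      ≡ ∑ (gauss (length u) j) (λ c → ψ (m u + c))

    ∑-maj∞-just-just : ∀ x y u j (ψ : ℕ → ℕ) →
      ∑ (masks (length u) j) (λ b → ψ (maj∞ (just x ∷ just y ∷ shuffle b u)))
      ≡ ∑ (gauss (length u) j) (λ c → ψ ((if gt y x then suc (length u + j) else 0) + (m (y ∷ u) + j + c)))
    ∑-maj∞-just-just x y u j ψ = trans
      (∑-cong∈ (masks (length u) j) λ {b} p →
        cong (λ i → ψ ((if gt y x then suc i else 0) + maj∞ (just y ∷ shuffle b u))) (length-shuffle u j p))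
      (∑-maj∞-just y u j (λ i → ψ ((if gt y x then suc (length u + j) else 0) + i)))

    ∑-maj∞-just-nothing : ∀ x u j (ψ : ℕ → ℕ) →
      ∑ (masks (length u) j) (λ b → ψ (maj∞ (just x ∷ nothing ∷ shuffle b u)))
      ≡ ∑ (gauss (length u) j) (λ c → ψ (suc (length u + j) + (m u + c)))
    ∑-maj∞-just-nothing x u j ψ = trans
      (∑-cong∈ (masks (length u) j) λ {b} p → cong ψ (cong₂ _+_ (cong suc (length-shuffle u j p)) (maj∞-nothing∷ (shuffle b u))))
      (∑-maj∞ u j (λ i → ψ (suc (length u + j) + i)))

    ∑-maj∞-just x [] zero ψ = refl
    ∑-maj∞-just x [] (suc j) ψ = trans (∑-map (false ∷_) (masks 0 j)) (∑-maj∞-just-nothing x [] j ψ)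
    ∑-maj∞-just x (y ∷ u) zero ψ = begin
      _ ≡⟨ ∑-map (true ∷_) (masks (length u) 0) ⟩
      _ ≡⟨ ∑-maj∞-just-just x y u 0 ψ ⟩
      _ ≡⟨ ∑-gauss-0ʳ (length u) ⟩
      ψ (d (length u + 0) + (m (y ∷ u) + 0 + 0))
        ≡⟨ cong ψ (trans (cong (λ i → d i + (m (y ∷ u) + 0 + 0)) (+-identityʳ (length u)))
             (e (d (length u)) (m (y ∷ u)))) ⟩
      ψ (d (length u) + m (y ∷ u) + 0 + 0)
        ≡⟨ +-identityʳ _ ⟨
      _ ∎
      where
      open ≡-Reasoning
      d : ℕ → ℕ
      d i = if gt y x then suc i else 0
      e : ∀ a b → a + (b + 0 + 0) ≡ a + b + 0 + 0
      e = solve-∀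
    ∑-maj∞-just x (y ∷ u) (suc j) ψ = trans (trans (∑-masks (length u) j)
      (cong₂ _+_ (∑-maj∞-just-just x y u (suc j) ψ) (∑-maj∞-just-nothing x (y ∷ u) j ψ))) pascal
      where
      k = length u
      M = m (y ∷ u)
      pascal : ∑ (gauss k (suc j)) (λ c → ψ ((if gt y x then suc (k + suc j) else 0) + (M + suc j + c)))
        + ∑ (gauss (suc k) j) (λ c → ψ (suc (suc k + j) + (M + c)))
        ≡ ∑ (gauss (suc k) (suc j)) (λ c → ψ ((if gt y x then suc k else 0) + M + suc j + c))
      pascal with gt y x
      ... | true = trans (+-comm (∑ (gauss k (suc j)) _) _) (trans
        (cong₂ _+_ (∑-cong (gauss (suc k) j) λ c → cong ψ (e₁ k j M c)) (∑-cong (gauss k (suc j)) λ c → cong ψ (e₂ k j M c)))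
        (sym (∑-gauss k j _)))
        where
        e₁ : ∀ k j M c → suc (suc k + j) + (M + c) ≡ suc k + M + suc j + c
        e₁ = solve-∀
        e₂ : ∀ k j M c → suc (k + suc j) + (M + suc j + c) ≡ suc k + M + suc j + (suc j + c)
        e₂ = solve-∀
      ... | false = trans
        (cong (∑ (gauss k (suc j)) (λ c → ψ (M + suc j + c)) +_) (∑-cong (gauss (suc k) j) λ c → cong ψ (e k j M c)))
        (sym (∑-gauss′ k j _))
        where
        e : ∀ k j M c → suc (suc k + j) + (M + c) ≡ M + suc j + (suc k + c)
        e = solve-∀

    ∑-maj∞ [] zero ψ = refl
    ∑-maj∞ [] (suc j) ψ = trans (∑-map (false ∷_) (masks 0 j))
      (trans (∑-cong (masks 0 j) λ b → cong ψ (maj∞-nothing∷ (shuffle b []))) (∑-maj∞ [] j ψ))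
    ∑-maj∞ (x ∷ u) zero ψ = trans (∑-map (true ∷_) (masks (length u) 0))
      (trans (∑-maj∞-just x u 0 ψ) (trans (∑-gauss-0ʳ (length u))
        (sym (trans (+-identityʳ _) (cong ψ (sym (+-identityʳ (m (x ∷ u) + 0))))))))
    ∑-maj∞ (x ∷ u) (suc j) ψ = begin
      _ ≡⟨ ∑-masks k j ⟩
      _ ≡⟨ cong₂ _+_ (∑-maj∞-just x u (suc j) ψ)
             (∑-cong (masks (suc k) j) λ b → cong ψ (maj∞-nothing∷ (shuffle b (x ∷ u)))) ⟩
      _ ≡⟨ cong₂ _+_ refl (∑-maj∞ (x ∷ u) j ψ) ⟩
      _ ≡⟨ +-comm (∑ (gauss k (suc j)) _) _ ⟩
      _ ≡⟨ cong₂ _+_ refl (∑-cong (gauss k (suc j)) λ c → cong ψ (+-assoc (m (x ∷ u)) (suc j) c)) ⟩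
      _ ≡⟨ ∑-gauss k j (λ c → ψ (m (x ∷ u) + c)) ⟨
      _ ∎
      where
      open ≡-Reasoning
      k = length u

    ∑-maj-∞-just : ∀ x u j (ψ : ℕ → ℕ) → ∑ (masks (length u) j) (λ b → ψ (maj-∞ (just x ∷ shuffle b u)))
      ≡ ∑ (gauss (length u) j) (λ c → ψ (m (x ∷ u) + c))
    -- For minimal letters it is an inserted letter in last place that costs a descent: `u` followed
    -- by one such letter has an extra descent at position `length u`, hence the shift. With a
    -- letter of the given word in last place there is no shift at all.
    ∑-maj-∞-nothing : ∀ u j (ψ : ℕ → ℕ) → ∑ (masks (length u) j) (λ b → ψ (maj-∞ (nothing ∷ shuffle b u)))
      ≡ ∑ (gauss (length u) j) (λ c → ψ (length u + (m u + c)))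

    ∑-maj-∞-just-just : ∀ x y u j (ψ : ℕ → ℕ) →
      ∑ (masks (length u) j) (λ b → ψ (maj-∞ (just x ∷ just y ∷ shuffle b u)))
      ≡ ∑ (gauss (length u) j) (λ c → ψ ((if gt y x then suc (length u + j) else 0) + (m (y ∷ u) + c)))
    ∑-maj-∞-just-just x y u j ψ = trans
      (∑-cong∈ (masks (length u) j) λ {b} p →
        cong (λ i → ψ ((if gt y x then suc i else 0) + maj-∞ (just y ∷ shuffle b u))) (length-shuffle u j p))
      (∑-maj-∞-just y u j (λ i → ψ ((if gt y x then suc (length u + j) else 0) + i)))

    ∑-maj-∞-nothing-just : ∀ x u j (ψ : ℕ → ℕ) →
      ∑ (masks (length u) j) (λ b → ψ (maj-∞ (nothing ∷ just x ∷ shuffle b u)))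
      ≡ ∑ (gauss (length u) j) (λ c → ψ (suc (length u + j) + (m (x ∷ u) + c)))
    ∑-maj-∞-nothing-just x u j ψ = trans
      (∑-cong∈ (masks (length u) j) λ {b} p →
        cong (λ i → ψ (suc i + maj-∞ (just x ∷ shuffle b u))) (length-shuffle u j p))
      (∑-maj-∞-just x u j (λ i → ψ (suc (length u + j) + i)))

    ∑-maj-∞-just x [] zero ψ = refl
    ∑-maj-∞-just x [] (suc j) ψ = trans (∑-map (false ∷_) (masks 0 j)) (∑-maj-∞-nothing [] j ψ)
    ∑-maj-∞-just x (y ∷ u) zero ψ = begin
      _ ≡⟨ ∑-map (true ∷_) (masks (length u) 0) ⟩
      _ ≡⟨ ∑-maj-∞-just-just x y u 0 ψ ⟩
      _ ≡⟨ ∑-gauss-0ʳ (length u) ⟩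
      ψ (d (length u + 0) + (m (y ∷ u) + 0))
        ≡⟨ cong ψ (trans (cong (λ i → d i + (m (y ∷ u) + 0)) (+-identityʳ (length u)))
             (sym (+-assoc (d (length u)) (m (y ∷ u)) 0))) ⟩
      ψ (d (length u) + m (y ∷ u) + 0)
        ≡⟨ +-identityʳ _ ⟨
      _ ∎
      where
      open ≡-Reasoning
      d : ℕ → ℕ
      d i = if gt y x then suc i else 0
    ∑-maj-∞-just x (y ∷ u) (suc j) ψ = trans (trans (∑-masks (length u) j)
      (cong₂ _+_ (∑-maj-∞-just-just x y u (suc j) ψ) (∑-maj-∞-nothing (y ∷ u) j ψ))) pascal
      where
      k = length u
      M = m (y ∷ u)
      pascal : ∑ (gauss k (suc j)) (λ c → ψ ((if gt y x then suc (k + suc j) else 0) + (M + c)))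
        + ∑ (gauss (suc k) j) (λ c → ψ (suc k + (M + c)))
        ≡ ∑ (gauss (suc k) (suc j)) (λ c → ψ ((if gt y x then suc k else 0) + M + c))
      pascal with gt y x
      ... | true = trans (+-comm (∑ (gauss k (suc j)) _) _) (trans
        (cong₂ _+_ (∑-cong (gauss (suc k) j) λ c → cong ψ (e₁ k M c)) (∑-cong (gauss k (suc j)) λ c → cong ψ (e₂ k j M c)))
        (sym (∑-gauss k j _)))
        where
        e₁ : ∀ k M c → suc k + (M + c) ≡ suc k + M + c
        e₁ = solve-∀
        e₂ : ∀ k j M c → suc (k + suc j) + (M + c) ≡ suc k + M + (suc j + c)
        e₂ = solve-∀
      ... | false = trans
        (cong (∑ (gauss k (suc j)) (λ c → ψ (M + c)) +_) (∑-cong (gauss (suc k) j) λ c → cong ψ (e k M c)))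
        (sym (∑-gauss′ k j _))
        where
        e : ∀ k M c → suc k + (M + c) ≡ M + (suc k + c)
        e = solve-∀

    ∑-maj-∞-nothing [] zero ψ = refl
    ∑-maj-∞-nothing [] (suc j) ψ = trans (∑-map (false ∷_) (masks 0 j)) (∑-maj-∞-nothing [] j ψ)
    ∑-maj-∞-nothing (x ∷ u) zero ψ = trans (∑-map (true ∷_) (masks (length u) 0))
      (trans (∑-maj-∞-nothing-just x u 0 ψ) (trans (∑-gauss-0ʳ (length u))
        (trans (cong (λ i → ψ (suc i + (m (x ∷ u) + 0))) (+-identityʳ (length u))) (sym (+-identityʳ _)))))
    ∑-maj-∞-nothing (x ∷ u) (suc j) ψ = begin
      _ ≡⟨ ∑-masks k j ⟩
      _ ≡⟨ cong₂ _+_ (∑-maj-∞-nothing-just x u (suc j) ψ) (∑-maj-∞-nothing (x ∷ u) j ψ) ⟩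
      _ ≡⟨ +-comm (∑ (gauss k (suc j)) _) _ ⟩
      _ ≡⟨ cong₂ _+_ refl (∑-cong (gauss k (suc j)) λ c → cong ψ (e k j M c)) ⟩
      _ ≡⟨ ∑-gauss k j _ ⟨
      _ ∎
      where
      open ≡-Reasoning
      k = length u
      M = m (x ∷ u)
      e : ∀ k j M c → suc (k + suc j) + (M + c) ≡ suc k + (M + (suc j + c))
      e = solve-∀

    ∑-maj-∞ : ∀ u j (ψ : ℕ → ℕ) → ∑ (masks (length u) j) (λ b → ψ (maj-∞ (shuffle b u)))
      ≡ ∑ (gauss (length u) j) (λ c → ψ (m u + c))
    ∑-maj-∞ [] zero ψ = refl
    ∑-maj-∞ [] (suc j) ψ = trans (∑-map (false ∷_) (masks 0 j)) (∑-maj-∞-nothing [] j ψ)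
    ∑-maj-∞ (x ∷ u) zero ψ = trans (∑-map (true ∷_) (masks (length u) 0))
      (trans (∑-maj-∞-just x u 0 ψ) (trans (∑-gauss-0ʳ (length u)) (sym (+-identityʳ _))))
    ∑-maj-∞ (x ∷ u) (suc j) ψ = begin
      _ ≡⟨ ∑-masks k j ⟩
      _ ≡⟨ cong₂ _+_ (∑-maj-∞-just x u (suc j) ψ) (∑-maj-∞-nothing (x ∷ u) j ψ) ⟩
      _ ≡⟨ cong₂ _+_ refl (∑-cong (gauss (suc k) j) λ c → cong ψ (x∙yz≈y∙xz (suc k) (m (x ∷ u)) c)) ⟩
      _ ≡⟨ ∑-gauss′ k j _ ⟨
      _ ∎
      where
      open ≡-Reasoning
      k = length u

-- Symmetric unimodal sequences

-- Here `c` is twice the centre. The ends of the support are not recorded, so the zero sequence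
-- qualifies for every `c` and sums with a common centre need no case distinction. Growth is
-- required up to the middle only; the other half follows by symmetry.
record SymmetricUnimodal (c : ℕ) (f : ℕ → ℕ) : Set where
  constructor mk
  field
    symmetric : ∀ i j → i + j ≡ c → f i ≡ f j
    vanishing : ∀ i → c < i → f i ≡ 0
    increasing : ∀ i → suc (i + i) ≤ c → f i ≤ f (suc i)

open SymmetricUnimodal

su-cong : ∀ {c f g} → (∀ i → f i ≡ g i) → SymmetricUnimodal c f → SymmetricUnimodal c g
su-cong h s .symmetric i j e = trans (sym (h i)) (trans (symmetric s i j e) (h j))
su-cong h s .vanishing i lt = trans (sym (h i)) (vanishing s i lt)
su-cong h s .increasing i le = subst₂ _≤_ (h i) (h (suc i)) (increasing s i le)

su-zero : ∀ {c} → SymmetricUnimodal c (λ _ → 0)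
su-zero = mk (λ _ _ _ → refl) (λ _ _ → refl) (λ _ _ → z≤n)

su-+ : ∀ {c f g} → SymmetricUnimodal c f → SymmetricUnimodal c g → SymmetricUnimodal c (λ i → f i + g i)
su-+ s t .symmetric i j e = cong₂ _+_ (symmetric s i j e) (symmetric t i j e)
su-+ s t .vanishing i lt = cong₂ _+_ (vanishing s i lt) (vanishing t i lt)
su-+ s t .increasing i le = +-mono-≤ (increasing s i le) (increasing t i le)

su-∑ : ∀ {A : Set} {c} (xs : List A) {f : A → ℕ → ℕ} → (∀ {x} → x ∈ xs → SymmetricUnimodal c (f x)) →
  SymmetricUnimodal c (λ i → ∑ xs (λ x → f x i))
su-∑ [] h = su-zero
su-∑ (x ∷ xs) h = su-+ (h (here refl)) (su-∑ xs (h ∘ there))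

su-rising : ∀ {c f} → SymmetricUnimodal c f → ∀ {i j} → i ≤′ j → j + j ≤ c → f i ≤ f j
su-rising s (≤′-reflexive refl) _ = ≤-refl
su-rising {c} s {j = suc j} (≤′-step i≤′j) le = ≤-trans (su-rising s i≤′j (<⇒≤ le′)) (increasing s j le′)
  where
  le′ : suc (j + j) ≤ c
  le′ = ≤-trans (s≤s (+-monoʳ-≤ j (n≤1+n j))) le

-- If `j` lies past the middle it is reflected: `i + j ≤ c` says that `c ∸ j` is still at least `i`,
-- and both are in the rising half. Terms on opposite sides of the centre can thus be compared.
su-≤ : ∀ {c f} → SymmetricUnimodal c f → ∀ i j → i ≤ j → i + j ≤ c → f i ≤ f j
su-≤ {c} {f} s i j i≤j i+j≤c with j + j ≤? c
... | yes 2j≤c = su-rising s (≤⇒≤′ i≤j) 2j≤c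
... | no 2j≰c = subst (f i ≤_) (symmetric s (c ∸ j) j (m∸n+n≡m j≤c))
      (su-rising s (≤⇒≤′ (m+n≤o⇒m≤o∸n i i+j≤c)) (≤-trans (+-monoʳ-≤ (c ∸ j) c∸j≤j) (≤-reflexive (m∸n+n≡m j≤c))))
  where
  j≤c : j ≤ c
  j≤c = m+n≤o⇒n≤o i i+j≤c
  c∸j≤j : c ∸ j ≤ j
  c∸j≤j = m≤n+o⇒m∸n≤o c j (<⇒≤ (≰⇒> 2j≰c))

shift : (ℕ → ℕ) → ℕ → ℕ
shift f zero = 0
shift f (suc i) = f i

su-shift : ∀ {c f} → SymmetricUnimodal c f → SymmetricUnimodal (2 + c) (shift f)
su-shift s .symmetric zero zero ()
su-shift s .symmetric zero (suc j) e = sym (vanishing s j (≤-reflexive (sym (suc-injective e))))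
su-shift s .symmetric (suc i) zero e = vanishing s i (≤-reflexive (sym (suc-injective (trans (sym (+-identityʳ _)) e))))
su-shift s .symmetric (suc i) (suc j) e = symmetric s i j (suc-injective (suc-injective (trans (cong suc (sym (+-suc i j))) e)))
su-shift s .vanishing (suc i) (s≤s lt) = vanishing s i (<⇒≤ lt)
su-shift s .increasing zero _ = z≤n
su-shift {c} s .increasing (suc i) (s≤s (s≤s le)) = increasing s i (subst (_≤ c) (+-suc i i) le)

shiftBy : ℕ → (ℕ → ℕ) → ℕ → ℕ
shiftBy zero f = f
shiftBy (suc a) f = shift (shiftBy a f)

-- coefficients of (1 + t + ⋯ + t^(a-1)) f
brick : ℕ → (ℕ → ℕ) → ℕ → ℕ
brick zero f i = 0
brick (suc a) f i = f i + shift (brick a f) i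

-- The block of powers is split at its top instead of its bottom. Reflection exchanges the two
-- splittings, which gives symmetry; comparing them in neighbouring degrees gives growth.
brick-sucʳ : ∀ a f i → brick (suc a) f i ≡ brick a f i + shiftBy a f i
brick-sucʳ zero f zero = +-identityʳ _
brick-sucʳ zero f (suc i) = +-identityʳ _
brick-sucʳ (suc a) f zero = sym (+-identityʳ _)
brick-sucʳ (suc a) f (suc i) = trans (cong (f (suc i) +_) (brick-sucʳ a f i)) (sym (+-assoc (f (suc i)) _ _))

module _ {c f} (s : SymmetricUnimodal c f) where

  brick-vanishing : ∀ a i → c + a ≤ i → brick a f i ≡ 0
  brick-vanishing zero i le = refl
  brick-vanishing (suc a) zero le with () ← subst (_≤ 0) (+-suc c a) le
  brick-vanishing (suc a) (suc i) le = cong₂ _+_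
    (vanishing s (suc i) (s≤s (≤-trans (m≤m+n c a) le′))) (brick-vanishing a i le′)
    where
    le′ : c + a ≤ i
    le′ = s≤s⁻¹ (subst (_≤ suc i) (+-suc c a) le)

  shiftBy-symmetric : ∀ a i j → i + j ≡ c + a → f i ≡ shiftBy a f j
  shiftBy-symmetric zero i j e = symmetric s i j (trans e (+-identityʳ c))
  shiftBy-symmetric (suc a) i zero e = vanishing s i
    (subst (c <_) (trans (sym e) (+-identityʳ i)) (subst (c <_) (sym (+-suc c a)) (s≤s (m≤m+n c a))))
  shiftBy-symmetric (suc a) i (suc j) e = shiftBy-symmetric a i j
    (suc-injective (trans (sym (+-suc i j)) (trans e (+-suc c a))))

  brick-symmetric : ∀ a i j → suc (i + j) ≡ c + a → brick a f i ≡ brick a f j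
  brick-symmetric zero i j e = refl
  brick-symmetric (suc a) i j e = begin
    f i + shift (brick a f) i ≡⟨ cong₂ _+_ (shiftBy-symmetric a i j e′) (shifted i e′) ⟩
    shiftBy a f j + brick a f j ≡⟨ +-comm (shiftBy a f j) _ ⟩
    brick a f j + shiftBy a f j ≡⟨ brick-sucʳ a f j ⟨
    brick (suc a) f j ∎
    where
    open ≡-Reasoning
    e′ : i + j ≡ c + a
    e′ = suc-injective (trans e (+-suc c a))
    shifted : ∀ i → i + j ≡ c + a → shift (brick a f) i ≡ brick a f j
    shifted zero e = sym (brick-vanishing a j (≤-reflexive (sym e)))
    shifted (suc i) e = brick-symmetric a i j e

  shiftBy-≤ : ∀ a i j → i ≤ a + j → i + j ≤ c + a → shiftBy a f i ≤ f j
  shiftBy-≤ zero i j le le′ = su-≤ s i j le (subst (i + j ≤_) (+-identityʳ c) le′)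
  shiftBy-≤ (suc a) zero j le le′ = z≤n
  shiftBy-≤ (suc a) (suc i) j le le′ = shiftBy-≤ a i j (s≤s⁻¹ le) (s≤s⁻¹ (subst (suc (i + j) ≤_) (+-suc c a) le′))

  su-brick : ∀ a → SymmetricUnimodal (c + a) (brick (suc a) f)
  su-brick a .symmetric i j e = brick-symmetric (suc a) i j (trans (cong suc e) (sym (+-suc c a)))
  su-brick a .vanishing i lt = brick-vanishing (suc a) i (subst (_≤ i) (sym (+-suc c a)) lt)
  -- From degree `i` to `suc i` the product gains `f (suc i)` and loses the coefficient of `f` in
  -- degree i - a, if there is one; the gained term is at least as close to the centre.
  su-brick a .increasing i le = subst₂ _≤_ (sym (brick-sucʳ a f i)) (+-comm (brick a f i) (f (suc i)))
    (+-monoʳ-≤ (brick a f i) (shiftBy-≤ a i (suc i)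
      (≤-trans (n≤1+n i) (m≤n+m (suc i) a)) (subst (_≤ c + a) (sym (+-suc i i)) le)))

-- From coefficient sequences to symmetry and unimodality in t

least : ∀ {P : ℕ → Set} → (∀ k → Dec (P k)) → ∀ n → P n → ∃ λ r → P r × (∀ k → k < r → ¬ P k)
least {P} P? n pn with anyUpTo? P? n
... | no none = n , pn , λ k k<n pk → none (k , k<n , pk)
... | yes (k , k<n , pk) = least′ n k k<n pk
  where
  least′ : ∀ n k → k < n → P k → ∃ λ r → P r × (∀ k → k < r → ¬ P k)
  least′ (suc n) k (s≤s k≤n) pk with anyUpTo? P? k
  ... | no none = k , pk , λ i i<k pi → none (i , i<k , pi)
  ... | yes (i , i<k , pi) = least′ n i (≤-trans i<k k≤n) pi

n/2≡⌊n/2⌋ : ∀ n → n / 2 ≡ ⌊ n /2⌋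
n/2≡⌊n/2⌋ zero = refl
n/2≡⌊n/2⌋ (suc zero) = refl
n/2≡⌊n/2⌋ (suc (suc n)) = trans (+-distrib-/-∣ˡ {2} n {2} (divides 1 refl)) (cong suc (n/2≡⌊n/2⌋ n))

module _ (P : TQPoly) (c : ℕ) (P-su : ∀ m → SymmetricUnimodal c (λ k → P k m))
  (nonZero? : ∀ k → Dec (NonZeroQ (P k))) where

  private
    ¬nonZero : ∀ k → ¬ NonZeroQ (P k) → P k ≈q (λ _ → 0)
    ¬nonZero k ¬nz m with P k m in e
    ... | zero = refl
    ... | suc i = ⊥-elim (¬nz (m , λ z → 1+n≢0 (trans (sym e) z)))

    -- The lower end is the least degree in which some power of q occurs. Since every power of q has
    -- the same centre, the upper end must be its mirror image `c ∸ r`.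
    support : NonZeroT P → ∃ λ r → ∃ λ s → r + s ≡ c × Support P r s
    support (k₀ , nz₀) with r , (m , nz) , below ← least nonZero? k₀ nz₀ =
      r , c ∸ r , r+s≡c , (m , nz) , (m , nz ∘ trans (symmetric (P-su m) r (c ∸ r) r+s≡c))
      , (λ k k<r → ¬nonZero k (below k k<r)) , above
      where
      r≤c : r ≤ c
      r≤c = ≮⇒≥ λ c<r → nz (vanishing (P-su m) r c<r)
      r+s≡c : r + (c ∸ r) ≡ c
      r+s≡c = m+[n∸m]≡n r≤c
      above : ∀ k → c ∸ r < k → P k ≈q (λ _ → 0)
      above k s<k m′ with k ≤? c
      ... | no k≰c = vanishing (P-su m′) k (≰⇒> k≰c)
      ... | yes k≤c = trans (symmetric (P-su m′) k (c ∸ k) (m+[n∸m]≡n k≤c))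
        (¬nonZero (c ∸ k) (below (c ∸ k) (subst (c ∸ k <_) (m∸[m∸n]≡n r≤c) (∸-monoʳ-< s<k k≤c))) m′)

  tSymmetricCenter : NonZeroT P → TSymmetricCenter P c
  tSymmetricCenter nz with r , s , r+s≡c , sup ← support nz = r , s , sup , r+s≡c ,
    λ i i≤s∸r m → symmetric (P-su m) (r + i) (s ∸ i) (begin
      r + i + (s ∸ i)   ≡⟨ +-assoc r i (s ∸ i) ⟩
      r + (i + (s ∸ i)) ≡⟨ cong (r +_) (m+[n∸m]≡n (≤-trans i≤s∸r (m∸n≤m s r))) ⟩
      r + s             ≡⟨ r+s≡c ⟩
      c ∎)
    where open ≡-Reasoning

  tUnimodal : NonZeroT P → TUnimodal P
  tUnimodal nz with r , s , refl , sup ← support nz = r , s , sup ,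
    (λ k _ k<h m → increasing (P-su m) k
      (subst (suc (k + k) ≤_) halves (+-mono-≤ k<h (≤-trans (n≤1+n k) (≤-trans k<h h≤h′))))) ,
    (λ m → symmetric (P-su m) h h′ halves) ,
    falling
    where
    h = (r + s) / 2
    h′ = suc (r + s) / 2
    halves : h + h′ ≡ r + s
    halves = trans (cong₂ _+_ (n/2≡⌊n/2⌋ (r + s)) (n/2≡⌊n/2⌋ (suc (r + s)))) (⌊n/2⌋+⌈n/2⌉≡n (r + s))
    h≤h′ : h ≤ h′
    h≤h′ = /-monoˡ-≤ 2 (n≤1+n (r + s))
    falling : ∀ k → h′ ≤ k → suc k ≤ s → P (suc k) ≤q P k
    -- Reflection turns the step from `k` to `suc k` in the falling half into the step from `i` to
    -- `suc i` in the rising half.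
    falling k h′≤k k<s m = subst₂ _≤_ (symmetric (P-su m) i (suc k) i+k≡c) (symmetric (P-su m) (suc i) k (trans (sym (+-suc i k)) i+k≡c))
      (su-≤ (P-su m) i (suc i) (n≤1+n i) i+i<c)
      where
      i = r + s ∸ suc k
      i+k≡c : i + suc k ≡ r + s
      i+k≡c = m∸n+n≡m (≤-trans k<s (m≤n+m s r))
      c≤k+k : r + s ≤ k + k
      c≤k+k = subst (_≤ k + k) halves (+-mono-≤ (≤-trans h≤h′ h′≤k) h′≤k)
      i+i<c : i + suc i ≤ r + s
      i+i<c = subst (i + suc i ≤_) i+k≡c (+-monoʳ-≤ i (s≤s (+-cancelʳ-≤ k i k
        (≤-trans (+-monoʳ-≤ i (n≤1+n k)) (subst (_≤ k + k) (sym i+k≡c) c≤k+k)))))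

-- The exponent m ranges over all integers and cannot be searched directly. But the coefficients
-- count entries of a finite list, so one is nonzero exactly if some entry passes the conditions
-- other than that on `v`, and the value of `v` there is the witness.
nonZeroQ? : ∀ {A : Set} (p : A → Bool) (t : A → ℕ) (v : A → ℤ) xs k →
  Dec (NonZeroQ (λ m → count (λ x → p x ∧ (t x ≡ᵇ k) ∧ ⌊ v x ℤP.≟ m ⌋) xs))
nonZeroQ? p t v [] k = no λ (m , nz) → nz refl
nonZeroQ? {A} p t v (x ∷ xs) k = by-head _ refl
  where
  c : ℤ → List A → ℕ
  c m = count (λ y → p y ∧ (t y ≡ᵇ k) ∧ ⌊ v y ℤP.≟ m ⌋)
  c-∷ : ∀ {b} m → p x ∧ (t x ≡ᵇ k) ≡ b → c m (x ∷ xs) ≡ 𝟙 (b ∧ ⌊ v x ℤP.≟ m ⌋) + c m xs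
  c-∷ m refl = trans (length-filterᵇ _ (x ∷ xs)) (cong₂ (λ b i → 𝟙 b + i)
    (sym (∧-assoc (p x) _ _)) (sym (length-filterᵇ _ xs)))
  by-head : ∀ b → p x ∧ (t x ≡ᵇ k) ≡ b → Dec (NonZeroQ (λ m → c m (x ∷ xs)))
  by-head true e = yes (v x , λ z → 1+n≢0
    (trans (sym (cong (λ b → 𝟙 b + c (v x) xs) (trans (isYes≗does (v x ℤP.≟ v x)) (dec-true (v x ℤP.≟ v x) refl)))) (trans (sym (c-∷ {true} (v x) e)) z)))
  by-head false e = map′ (λ (m , nz) → m , nz ∘ trans (sym (c-∷ {false} m e))) (λ (m , nz) → m , nz ∘ trans (c-∷ {false} m e))
    (nonZeroQ? p t v xs k)

-- The recurrence in t and q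

su-centre : ∀ {c c′ f} → c ≡ c′ → SymmetricUnimodal c f → SymmetricUnimodal c′ f
su-centre refl s = s

antidiagonal : ℕ → List (ℕ × ℕ)
antidiagonal zero = (0 , 0) ∷ []
antidiagonal (suc n) = (suc n , 0) ∷ map (λ (k , j) → k , suc j) (antidiagonal n)

∈-antidiagonal : ∀ n {k j} → (k , j) ∈ antidiagonal n → k + j ≡ n
∈-antidiagonal zero (here refl) = refl
∈-antidiagonal (suc n) (here refl) = +-identityʳ (suc n)
∈-antidiagonal (suc n) (there p) with (k , j) , q , refl ← ∈-map⁻ _ p = trans (+-suc k j) (cong suc (∈-antidiagonal n q))

∈-antidiagonal⁺ : ∀ k j → (k , j) ∈ antidiagonal (k + j)
∈-antidiagonal⁺ zero zero = here refl
∈-antidiagonal⁺ (suc k) zero rewrite +-identityʳ k = here refl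
∈-antidiagonal⁺ k (suc j) rewrite +-suc k j = there (∈-map⁺ _ (∈-antidiagonal⁺ k j))

antidiagonal-unique : ∀ n → Unique (antidiagonal n)
antidiagonal-unique zero = [] ∷ []
antidiagonal-unique (suc n) = AllP.¬Any⇒All¬ _ (λ p → case (∈-map⁻ _ p)) ∷ Uniq.map⁺ (λ { refl → refl }) (antidiagonal-unique n)
  where
  case : ∃ (λ kj → kj ∈ antidiagonal n × (suc n , 0) ≡ (proj₁ kj , suc (proj₂ kj))) → ⊥
  case (_ , _ , ())

∈⇒≤∑ : ∀ {A : Set} {xs : List A} {f : A → ℕ} {x} → x ∈ xs → f x ≤ ∑ xs f
∈⇒≤∑ {xs = x ∷ xs} {f} (here refl) = m≤m+n (f x) _
∈⇒≤∑ {xs = y ∷ xs} {f} (there p) = ≤-trans (∈⇒≤∑ p) (m≤n+m _ (f y))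

-- A finite multiset of monomials t^a q^b is tested against arbitrary functions of (a , b).
Test : Set
Test = ℕ → ℕ → ℕ

δ : ℕ → (ℕ → ℕ) → Test
δ i ψ t q = if t ≡ᵇ i then ψ q else 0

-- Dual to multiplication by 1 + t + ⋯ + t^(a-1): testing a multiset against `interval a φ` amounts
-- to testing its product with the block against `φ`.
interval : ℕ → Test → Test
interval zero φ t q = 0
interval (suc a) φ t q = φ t q + interval a (φ ∘ suc) t q

interval-shift : ∀ a (φ : Test) t q b → interval a φ t (q + b) ≡ interval a (λ t q → φ t (q + b)) t q
interval-shift zero φ t q b = refl
interval-shift (suc a) φ t q b = cong (φ t (q + b) +_) (interval-shift a (φ ∘ suc) t q b)

interval-zero : ∀ a t q → interval a (λ _ _ → 0) t q ≡ 0
interval-zero zero t q = refl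
interval-zero (suc a) t q = interval-zero a t q

-- This is (1 - t)(1 + ⋯ + t^(a-1)) = 1 - t^a with the negative terms moved to the other side.
interval-telescope : ∀ a (φ : Test) t q →
  interval a φ t q + φ (t + a) q ≡ φ t q + interval a (φ ∘ suc) t q
interval-telescope zero φ t q = trans (cong (λ i → φ i q) (+-identityʳ t)) (sym (+-identityʳ _))
interval-telescope (suc a) φ t q = begin
  φ t q + interval a (φ ∘ suc) t q + φ (t + suc a) q
    ≡⟨ +-assoc (φ t q) _ _ ⟩
  φ t q + (interval a (φ ∘ suc) t q + φ (t + suc a) q)
    ≡⟨ cong (λ i → φ t q + (interval a (φ ∘ suc) t q + φ i q)) (+-suc t a) ⟩
  φ t q + (interval a (φ ∘ suc) t q + φ (suc t + a) q)
    ≡⟨ cong (φ t q +_) (interval-telescope a (φ ∘ suc) t q) ⟩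
  φ t q + interval (suc a) (φ ∘ suc) t q ∎
  where open ≡-Reasoning

module _ {W : Set} (tOf qOf : W → ℕ) where

  infix 5 ⟨_⟩_

  ⟨_⟩_ : List W → Test → ℕ
  ⟨ xs ⟩ φ = ∑ xs (λ w → φ (tOf w) (qOf w))

  -- Quantifying over all `ψ` treats every power of q at once and makes the property stable under
  -- Gaussian factors: a shift of the q-exponent merely replaces `ψ` by another function.
  SUMultiset : ℕ → List W → Set
  SUMultiset c xs = ∀ ψ → SymmetricUnimodal c (λ i → ⟨ xs ⟩ δ i ψ)

  ⟨⟩-interval : ∀ xs a i ψ → ⟨ xs ⟩ interval a (δ i ψ) ≡ brick a (λ i → ⟨ xs ⟩ δ i ψ) i
  ⟨⟩-interval xs zero i ψ = ∑-zero xs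
  ⟨⟩-interval xs (suc a) zero ψ = trans (∑-+ xs)
    (cong₂ _+_ refl (trans (∑-cong xs λ w → interval-zero a (tOf w) (qOf w)) (∑-zero xs)))
  ⟨⟩-interval xs (suc a) (suc i) ψ = trans (∑-+ xs) (cong₂ _+_ refl (⟨⟩-interval xs a i ψ))

  module _ (D : ℕ → List W) where

    gaussian : ℕ × ℕ → Test → ℕ
    gaussian (k , j) φ = ∑ (gauss k j) (λ b → ⟨ D k ⟩ (λ t q → φ t (q + b)))

    gaussian-cong : ∀ p {φ φ′ : Test} → (∀ t q → φ t q ≡ φ′ t q) → gaussian p φ ≡ gaussian p φ′
    gaussian-cong (k , j) h = ∑-cong (gauss k j) λ b → ∑-cong (D k) λ w → h (tOf w) (qOf w + b)

    gaussian-+ : ∀ p (φ φ′ : Test) → gaussian p (λ t q → φ t q + φ′ t q) ≡ gaussian p φ + gaussian p φ′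
    gaussian-+ (k , j) φ φ′ = trans (∑-cong (gauss k j) λ b → ∑-+ (D k)) (∑-+ (gauss k j))

    gaussian-zero : ∀ p → gaussian p (λ _ _ → 0) ≡ 0
    gaussian-zero (k , j) = trans (∑-cong (gauss k j) λ b → ∑-zero (D k)) (∑-zero (gauss k j))

    gaussian-0 : ∀ k (φ : Test) → gaussian (k , 0) φ ≡ (⟨ D k ⟩ φ)
    gaussian-0 k φ = trans (∑-gauss-0ʳ k) (∑-cong (D k) λ w → cong (φ (tOf w)) (+-identityʳ (qOf w)))

    su-gaussian : ∀ c k j → SUMultiset c (D k) → ∀ ψ → SymmetricUnimodal c (λ i → gaussian (k , j) (δ i ψ))
    su-gaussian c k j su ψ = su-∑ (gauss k j) λ {b} _ → su (λ q → ψ (q + b))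

    su-gaussian-interval : ∀ c k j a → SUMultiset c (D k) →
      ∀ ψ → SymmetricUnimodal (c + a) (λ i → gaussian (k , j) (interval (suc a) (δ i ψ)))
    su-gaussian-interval c k j a su ψ = su-∑ (gauss k j) λ {b} _ →
      su-cong (λ i → sym (trans (∑-cong (D k) λ w → interval-shift (suc a) (δ i ψ) (tOf w) (qOf w) b)
                                (⟨⟩-interval (D k) (suc a) i (λ q → ψ (q + b)))))
        (su-brick (su (λ q → ψ (q + b))) a)

    -- The block is t + ⋯ + t^a, whose own doubled centre is a + 1. It is empty for a = 0, which
    -- does occur (l = 1 and a single fixed point); the product is then zero and every centre is
    -- admissible.
    su-gaussian-t-interval : ∀ c k j a → SUMultiset c (D k) →
      ∀ ψ → SymmetricUnimodal (suc c + a) (λ i → gaussian (k , j) (interval a (δ i ψ ∘ suc)))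
    su-gaussian-t-interval c k j zero su ψ = su-cong (λ i → sym (gaussian-zero (k , j))) su-zero
    su-gaussian-t-interval c k j (suc a) su ψ = su-centre (cong suc (sym (+-suc c a)))
      (su-cong shifted (su-shift (su-gaussian-interval c k j a su ψ)))
      where
      shifted : ∀ i → shift (λ i → gaussian (k , j) (interval (suc a) (δ i ψ))) i ≡ gaussian (k , j) (interval (suc a) (δ i ψ ∘ suc))
      shifted zero = sym (trans (gaussian-cong (k , j) (interval-zero (suc a))) (gaussian-zero (k , j)))
      shifted (suc i) = refl

    total : ℕ → Test → ℕ
    total n φ = ∑ (antidiagonal n) (λ p → gaussian p φ)

    private
      Σ⁺ : ℕ → (ℕ × ℕ → ℕ) → ℕ
      Σ⁺ n h = ∑ (antidiagonal n) (λ (k , j) → h (k , suc j))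

      ∑-antidiagonal : ∀ n {h : ℕ × ℕ → ℕ} → ∑ (antidiagonal (suc n)) h ≡ h (suc n , 0) + Σ⁺ n h
      ∑-antidiagonal n = cong₂ _+_ refl (∑-map _ (antidiagonal n))

    -- The pair `(0 , n)` stands for the identity, all of whose letters are fixed points; its
    -- contribution `φ 0 0` later shows that A_n does not vanish.
    total-positive : (∀ φ → (⟨ D 0 ⟩ φ) ≡ φ 0 0) → ∀ n φ → φ 0 0 ≤ total n φ
    total-positive D₀ n φ = ≤-trans (≤-reflexive (sym (trans (+-identityʳ _) (D₀ (λ t q → φ t (q + 0))))))
      (∈⇒≤∑ {f = λ p → gaussian p φ} (∈-antidiagonal⁺ 0 n))

    module _ (l′ : ℕ) (rotation : ∀ n (φ : Test) → total (suc n) (φ ∘ suc)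
        ≡ ∑ (antidiagonal (suc n)) (λ (k , j) → gaussian (k , j) (λ t → φ (t + suc l′ * j)))) where

      private
        l = suc l′

        -- l * suc j ∸ 1
        a : ℕ → ℕ
        a j = j + l′ * suc j

        R : ℕ → Test → ℕ
        R n φ = ∑ (antidiagonal n) (λ (k , j) → gaussian (k , suc j) (interval (a j) (φ ∘ suc)))

        W⁺ V⁺ : ℕ → Test → ℕ
        W⁺ n φ = ∑ (antidiagonal n) (λ (k , j) → gaussian (k , suc j) (λ t → φ (t + l * suc j)))
        V⁺ n φ = Σ⁺ n (λ p → gaussian p (φ ∘ suc))

        D-telescope : ∀ n φ → (⟨ D (suc n) ⟩ φ) + W⁺ n φ ≡ (⟨ D (suc n) ⟩ φ ∘ suc) + V⁺ n φ
        D-telescope n φ = begin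
          (⟨ D (suc n) ⟩ φ) + W⁺ n φ
            ≡⟨ cong₂ _+_ (sym (trans (gaussian-cong (suc n , 0) λ t q → cong (λ i → φ i q) (t+l*0 t)) (gaussian-0 (suc n) φ))) refl ⟩
          gaussian (suc n , 0) (λ t → φ (t + l * 0)) + W⁺ n φ
            ≡⟨ ∑-antidiagonal n ⟨
          ∑ (antidiagonal (suc n)) (λ (k , j) → gaussian (k , j) (λ t → φ (t + l * j)))
            ≡⟨ rotation n φ ⟨
          total (suc n) (φ ∘ suc)
            ≡⟨ ∑-antidiagonal n ⟩
          gaussian (suc n , 0) (φ ∘ suc) + V⁺ n φ
            ≡⟨ cong₂ _+_ (gaussian-0 (suc n) (φ ∘ suc)) refl ⟩
          (⟨ D (suc n) ⟩ φ ∘ suc) + V⁺ n φ ∎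
          where
          open ≡-Reasoning
          t+l*0 : ∀ t → t + l * 0 ≡ t
          t+l*0 t = trans (cong (t +_) (*-zeroʳ l)) (+-identityʳ t)

        R-telescope : ∀ n φ → R n φ + W⁺ n φ ≡ R n (φ ∘ suc) + V⁺ n φ
        R-telescope n φ = begin
          R n φ + W⁺ n φ ≡⟨ ∑-+ (antidiagonal n) ⟨
          _ ≡⟨ ∑-cong (antidiagonal n) (λ (k , j) → term k j) ⟩
          _ ≡⟨ ∑-+ (antidiagonal n) ⟩
          R n (φ ∘ suc) + V⁺ n φ ∎
          where
          open ≡-Reasoning
          pointwise : ∀ j t q → interval (a j) (φ ∘ suc) t q + φ (t + l * suc j) q
            ≡ interval (a j) (φ ∘ suc ∘ suc) t q + φ (suc t) q
          pointwise j t q = trans (cong (λ i → interval (a j) (φ ∘ suc) t q + φ i q) (+-suc t (a j)))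
            (trans (interval-telescope (a j) (φ ∘ suc) t q) (+-comm (φ (suc t) q) _))
          term : ∀ k j → gaussian (k , suc j) (interval (a j) (φ ∘ suc)) + gaussian (k , suc j) (λ t → φ (t + l * suc j))
            ≡ gaussian (k , suc j) (interval (a j) (φ ∘ suc ∘ suc)) + gaussian (k , suc j) (φ ∘ suc)
          term k j = trans (sym (gaussian-+ (k , suc j) (interval (a j) (φ ∘ suc)) (λ t → φ (t + l * suc j))))
            (trans (gaussian-cong (k , suc j) (pointwise j)) (gaussian-+ (k , suc j) (interval (a j) (φ ∘ suc ∘ suc)) (φ ∘ suc)))

      -- D_n and R_n both solve (1 - t) X = V - W, which is cancelled degree by degree.
      D≡R : ∀ n i ψ → (⟨ D (suc n) ⟩ δ i ψ) ≡ R n (δ i ψ)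
      D≡R n i ψ = +-cancelʳ-≡ (W⁺ n (δ i ψ)) _ _ (begin
        (⟨ D (suc n) ⟩ δ i ψ) + W⁺ n (δ i ψ)       ≡⟨ D-telescope n (δ i ψ) ⟩
        (⟨ D (suc n) ⟩ δ i ψ ∘ suc) + V⁺ n (δ i ψ) ≡⟨ cong₂ _+_ (lower i) refl ⟩
        R n (δ i ψ ∘ suc) + V⁺ n (δ i ψ)           ≡⟨ R-telescope n (δ i ψ) ⟨
        R n (δ i ψ) + W⁺ n (δ i ψ) ∎)
        where
        open ≡-Reasoning
        lower : ∀ i → (⟨ D (suc n) ⟩ δ i ψ ∘ suc) ≡ R n (δ i ψ ∘ suc)
        -- The product t X has no constant term, so `δ 0 ψ ∘ suc` is the zero test; in higher degree
        -- `δ (suc i) ψ ∘ suc` is `δ i ψ`, to which the recursion applies.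
        lower zero = trans (∑-zero (D (suc n))) (sym (trans (∑-cong (antidiagonal n) λ (k , j) →
          trans (gaussian-cong (k , suc j) (interval-zero (a j))) (gaussian-zero (k , suc j))) (∑-zero (antidiagonal n))))
        lower (suc i) = D≡R n i ψ

      su-D : (∀ φ → (⟨ D 0 ⟩ φ) ≡ φ 0 0) → ∀ n → SUMultiset (l * n) (D n)
      su-D D₀ = <-rec _ step
        where
        D₀-su : SUMultiset 0 (D 0)
        D₀-su ψ = su-cong (λ i → sym (D₀ (δ i ψ))) (mk
          (λ { zero zero _ → refl }) (λ { (suc i) _ → refl }) (λ i ()))
        centre : ∀ k j → suc (l * k) + a j ≡ l * suc (k + j)
        centre k j = e l′ k j
          where
          e : ∀ l′ k j → suc (suc l′ * k) + (j + l′ * suc j) ≡ suc l′ * suc (k + j)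
          e = solve-∀
        step : ∀ n → (∀ {m} → m < n → SUMultiset (l * m) (D m)) → SUMultiset (l * n) (D n)
        step zero _ = subst (λ c → SUMultiset c (D 0)) (sym (*-zeroʳ l)) D₀-su
        step (suc n) ih ψ = su-cong (λ i → sym (D≡R n i ψ)) (su-∑ (antidiagonal n) λ {(k , j)} p →
          su-centre (trans (centre k j) (cong (λ i → l * suc i) (∈-antidiagonal n p)))
            (su-gaussian-t-interval (l * k) k (suc j) (a j) (ih (s≤s (m+n≤o⇒m≤o k (≤-reflexive (∈-antidiagonal n p))))) ψ))

      -- For each k < n, the summand of D_k in A_n supplies the power 1, and the recurrence for D_n
      -- supplies t, ..., t^(a j). Together they form an unbroken block starting at 1, whose doubled
      -- centre is one less than that of the block for D_n.
      total-su : (∀ φ → (⟨ D 0 ⟩ φ) ≡ φ 0 0) → ∀ n ψ → SymmetricUnimodal (l * suc n ∸ 1) (λ i → total (suc n) (δ i ψ))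
      total-su D₀ n ψ = su-cong (λ i → sym (total-intervals i)) (su-∑ (antidiagonal n) λ {(k , j)} p →
        su-centre (trans (centre l′ k j) (cong (λ i → l * suc i ∸ 1) (∈-antidiagonal n p)))
          (su-gaussian-interval (l * k) k (suc j) (a j) (su-D D₀ k) ψ))
        where
        centre : ∀ l′ k j → suc l′ * k + (j + l′ * suc j) ≡ k + j + l′ * suc (k + j)
        centre = solve-∀
        total-intervals : ∀ i → total (suc n) (δ i ψ)
          ≡ ∑ (antidiagonal n) (λ (k , j) → gaussian (k , suc j) (interval (suc (a j)) (δ i ψ)))
        total-intervals i = begin
          total (suc n) (δ i ψ)
            ≡⟨ ∑-antidiagonal n ⟩
          gaussian (suc n , 0) (δ i ψ) + Σ⁺ n (λ p → gaussian p (δ i ψ))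
            ≡⟨ cong₂ _+_ (trans (gaussian-0 (suc n) (δ i ψ)) (D≡R n i ψ)) refl ⟩
          R n (δ i ψ) + Σ⁺ n (λ p → gaussian p (δ i ψ))
            ≡⟨ +-comm (R n (δ i ψ)) _ ⟩
          Σ⁺ n (λ p → gaussian p (δ i ψ)) + R n (δ i ψ)
            ≡⟨ ∑-+ (antidiagonal n) ⟨
          _ ≡⟨ ∑-cong (antidiagonal n) (λ (k , j) → gaussian-+ (k , suc j) (δ i ψ) (interval (a j) (δ i ψ ∘ suc))) ⟨
          _ ∎
          where open ≡-Reasoning

-- Insertion and removal of fixed points

-- Different blocks are disjoint because `g` recovers the index of a block from each of its entries.
unique-concatMap : ∀ {A B : Set} (f : A → List B) (g : B → A) {xs} → Unique xs →
  (∀ {x} → x ∈ xs → Unique (f x)) → (∀ {x y} → x ∈ xs → y ∈ f x → g y ≡ x) → Unique (concatMap f xs)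
unique-concatMap f g {[]} _ _ _ = []
unique-concatMap f g {x ∷ xs} u@(_ ∷ u′) uf gf = Uniq.++⁺ (uf (here refl))
  (unique-concatMap f g u′ (uf ∘ there) (gf ∘ there)) λ (p , q) →
    let x′ , x′∈xs , y∈fx′ = find (∈-concatMap⁻ f {xs = xs} q)
    in Uniq.Unique[x∷xs]⇒x∉xs u (subst (_∈ xs) (trans (sym (gf (there x′∈xs) y∈fx′)) (gf (here refl) p)) x′∈xs)

-- Boolean comparisons and increasing maps

<ᵇ-true : ∀ {m n} → m < n → (m <ᵇ n) ≡ true
<ᵇ-true = Equivalence.to T-≡ ∘ <⇒<ᵇ

<ᵇ-false : ∀ {m n} → n ≤ m → (m <ᵇ n) ≡ false
<ᵇ-false {m} {n} n≤m with m <ᵇ n in e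
... | false = refl
... | true = contradiction (<ᵇ⇒< m n (Equivalence.from T-≡ e)) (≤⇒≯ n≤m)

≡ᵇ-true : ∀ {m n} → m ≡ n → (m ≡ᵇ n) ≡ true
≡ᵇ-true {m} {n} = Equivalence.to T-≡ ∘ ≡⇒≡ᵇ m n

≡ᵇ-false : ∀ {m n} → m ≢ n → (m ≡ᵇ n) ≡ false
≡ᵇ-false {m} {n} m≢n with m ≡ᵇ n in e
... | false = refl
... | true = contradiction (≡ᵇ⇒≡ m n (Equivalence.from T-≡ e)) m≢n

≡ᵇ⇒≡′ : ∀ m n → (m ≡ᵇ n) ≡ true → m ≡ n
≡ᵇ⇒≡′ m n = ≡ᵇ⇒≡ m n ∘ Equivalence.from T-≡

StrictMono : (ℕ → ℕ) → Set
StrictMono f = ∀ {x y} → x < y → f x < f y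

module _ {f} (mono : StrictMono f) where

  strictMono-injective : ∀ {x y} → f x ≡ f y → x ≡ y
  strictMono-injective {x} {y} e with <-cmp x y
  ... | tri< lt _ _ = contradiction e (<⇒≢ (mono lt))
  ... | tri≈ _ eq _ = eq
  ... | tri> _ _ gt = contradiction (sym e) (<⇒≢ (mono gt))

  strictMono-<ᵇ : ∀ x y → (f x <ᵇ f y) ≡ (x <ᵇ y)
  strictMono-<ᵇ x y with <-cmp x y
  ... | tri< lt _ _ = trans (<ᵇ-true (mono lt)) (sym (<ᵇ-true lt))
  ... | tri≈ _ refl _ = trans (<ᵇ-false {f x} ≤-refl) (sym (<ᵇ-false {x} ≤-refl))
  ... | tri> _ _ gt = trans (<ᵇ-false (<⇒≤ (mono gt))) (sym (<ᵇ-false (<⇒≤ gt)))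

  strictMono-≡ᵇ : ∀ x y → (f x ≡ᵇ f y) ≡ (x ≡ᵇ y)
  strictMono-≡ᵇ x y with x ≟ y
  ... | yes refl = trans (≡ᵇ-true {f x} refl) (sym (≡ᵇ-true {x} refl))
  ... | no x≢y = trans (≡ᵇ-false (x≢y ∘ strictMono-injective)) (sym (≡ᵇ-false x≢y))

-- The coface map: the increasing injection of ℕ that misses only `n`.
bump : ℕ → ℕ → ℕ
bump zero v = suc v
bump (suc n) zero = zero
bump (suc n) (suc v) = suc (bump n v)

bump-< : ∀ {n v} → v < n → bump n v ≡ v
bump-< {suc n} {zero} _ = refl
bump-< {suc n} {suc v} (s≤s lt) = cong suc (bump-< lt)

bump-≥ : ∀ {n v} → n ≤ v → bump n v ≡ suc v
bump-≥ {zero} _ = refl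
bump-≥ {suc n} (s≤s le) = cong suc (bump-≥ le)

bump-≢ : ∀ n v → bump n v ≢ n
bump-≢ (suc n) (suc v) e = bump-≢ n v (suc-injective e)

bump-mono : ∀ n → StrictMono (bump n)
bump-mono zero lt = s≤s lt
bump-mono (suc n) {zero} {suc y} lt = z<s
bump-mono (suc n) {suc x} {suc y} (s≤s lt) = s≤s (bump-mono n lt)

trues falses : List Bool → ℕ
trues [] = 0
trues (true ∷ b) = suc (trues b)
trues (false ∷ b) = trues b
falses [] = 0
falses (true ∷ b) = falses b
falses (false ∷ b) = suc (falses b)

trues+falses : ∀ b → trues b + falses b ≡ length b
trues+falses [] = refl
trues+falses (true ∷ b) = cong suc (trues+falses b)
trues+falses (false ∷ b) = trans (+-suc _ _) (cong suc (trues+falses b))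

∈-masks : ∀ b → b ∈ masks (trues b) (falses b)
∈-masks [] = here refl
∈-masks (true ∷ b) with falses b | ∈-masks b
... | zero | p = ∈-map⁺ (true ∷_) p
... | suc j | p = ∈-++⁺ˡ (∈-map⁺ (true ∷_) p)
∈-masks (false ∷ b) with trues b | ∈-masks b
... | zero | p = ∈-map⁺ (false ∷_) p
... | suc k | p = ∈-++⁺ʳ (map (true ∷_) (masks k (suc (falses b)))) (∈-map⁺ (false ∷_) p)

masks-counts : ∀ k j {b} → b ∈ masks k j → (trues b , falses b) ≡ (k , j)
masks-counts zero zero (here refl) = refl
masks-counts zero (suc j) p with _ , q , refl ← ∈-map⁻ (false ∷_) p = cong (λ (k , j) → k , suc j) (masks-counts zero j q)
masks-counts (suc k) zero p with _ , q , refl ← ∈-map⁻ (true ∷_) p = cong (λ (k , j) → suc k , j) (masks-counts k zero q)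
masks-counts (suc k) (suc j) p with ∈-++⁻ (map (true ∷_) (masks k (suc j))) p
... | inj₁ p′ with _ , q , refl ← ∈-map⁻ (true ∷_) p′ = cong (λ (k , j) → suc k , j) (masks-counts k (suc j) q)
... | inj₂ p′ with _ , q , refl ← ∈-map⁻ (false ∷_) p′ = cong (λ (k , j) → k , suc j) (masks-counts (suc k) j q)

masks-unique : ∀ k j → Unique (masks k j)
masks-unique zero zero = [] ∷ []
masks-unique zero (suc j) = Uniq.map⁺ ∷-injectiveʳ (masks-unique zero j)
masks-unique (suc k) zero = Uniq.map⁺ ∷-injectiveʳ (masks-unique k zero)
masks-unique (suc k) (suc j) = Uniq.++⁺ (Uniq.map⁺ ∷-injectiveʳ (masks-unique k (suc j)))
  (Uniq.map⁺ ∷-injectiveʳ (masks-unique (suc k) j)) disjoint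
  where
  disjoint : ∀ {b} → ¬ (b ∈ map (true ∷_) (masks k (suc j)) × b ∈ map (false ∷_) (masks (suc k) j))
  disjoint (p , q) with _ , _ , refl ← ∈-map⁻ (true ∷_) p with _ , _ , () ← ∈-map⁻ (false ∷_) q

-- The increasing bijection from ℕ onto the complement of the positions marked false.
embed : List Bool → ℕ → ℕ
embed [] v = v
embed (true ∷ b) v = embed b v
embed (false ∷ b) v = bump (length b) (embed b v)

embed-mono : ∀ b → StrictMono (embed b)
embed-mono [] lt = lt
embed-mono (true ∷ b) lt = embed-mono b lt
embed-mono (false ∷ b) lt = bump-mono (length b) (embed-mono b lt)

-- Beyond the part described by the mask, `embed b` is a translation. For `i = 0` this says that the
-- position of the next letter moves exactly as a value does, so comparisons of values with
-- positions survive the insertion.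
embed-+-trues : ∀ b i → embed b (i + trues b) ≡ i + length b
embed-+-trues [] i = refl
embed-+-trues (true ∷ b) i = trans (cong (embed b) (+-suc i (trues b)))
  (trans (embed-+-trues b (suc i)) (sym (+-suc i (length b))))
embed-+-trues (false ∷ b) i = trans (cong (bump (length b)) (embed-+-trues b i))
  (trans (bump-≥ (m≤n+m (length b) i)) (sym (+-suc i (length b))))

embed-< : ∀ b {v} → v < trues b → embed b v < length b
embed-< b {v} lt = subst (embed b v <_) (embed-+-trues b 0) (embed-mono b lt)

skipped : List Bool → List ℕ
skipped [] = []
skipped (true ∷ b) = skipped b
skipped (false ∷ b) = length b ∷ skipped b

skipped-< : ∀ b → All (_< length b) (skipped b)
skipped-< [] = []
skipped-< (true ∷ b) = All.map m≤n⇒m≤1+n (skipped-< b)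
skipped-< (false ∷ b) = ≤-refl ∷ All.map m≤n⇒m≤1+n (skipped-< b)

skipped-unique : ∀ b → Unique (skipped b)
skipped-unique [] = []
skipped-unique (true ∷ b) = skipped-unique b
skipped-unique (false ∷ b) = All.map (λ lt e → <⇒≢ lt (sym e)) (skipped-< b) ∷ skipped-unique b

embed-∉-skipped : ∀ b v → embed b v ∉ skipped b
embed-∉-skipped (true ∷ b) v p = embed-∉-skipped b v p
embed-∉-skipped (false ∷ b) v (here e) = bump-≢ (length b) (embed b v) e
embed-∉-skipped (false ∷ b) v (there p) with embed b v <? length b
... | yes lt = embed-∉-skipped b v (subst (_∈ skipped b) (bump-< lt) p)
... | no ≮ = ≮ (≤-trans (n≤1+n _) (subst (_< length b) (bump-≥ (≮⇒≥ ≮)) (All.lookup (skipped-< b) p)))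

embed-or-skipped : ∀ b {v} → v < length b → (∃ λ i → i < trues b × embed b i ≡ v) ⊎ v ∈ skipped b
embed-or-skipped (x ∷ b) {v} (s≤s v≤n) with m≤n⇒m<n∨m≡n v≤n
embed-or-skipped (true ∷ b) (s≤s v≤n) | inj₂ refl = inj₁ (trues b , ≤-refl , embed-+-trues b 0)
embed-or-skipped (false ∷ b) (s≤s v≤n) | inj₂ refl = inj₂ (here refl)
embed-or-skipped (true ∷ b) (s≤s v≤n) | inj₁ v<n with embed-or-skipped b v<n
... | inj₁ (i , lt , e) = inj₁ (i , m≤n⇒m≤1+n lt , e)
... | inj₂ p = inj₂ p
embed-or-skipped (false ∷ b) (s≤s v≤n) | inj₁ v<n with embed-or-skipped b v<n
... | inj₁ (i , lt , refl) = inj₁ (i , lt , bump-< v<n)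
... | inj₂ p = inj₂ (there p)

-- A letter is a pair (0-based value , colour); words are stored from right to left, as for majBy.
isFixed : ℕ → ℕ × ℕ → Bool
isFixed p (v , e) = (v ≡ᵇ p) ∧ (e ≡ᵇ 0)

relabel : (ℕ → ℕ) → ℕ × ℕ → ℕ × ℕ
relabel f (v , e) = f v , e

place : List Bool → List (ℕ × ℕ) → List (ℕ × ℕ)
place [] w = []
place (true ∷ b) [] = []
place (true ∷ b) (x ∷ w) = x ∷ place b w
place (false ∷ b) w = (length b , 0) ∷ place b w

insertFixed : List Bool → List (ℕ × ℕ) → List (ℕ × ℕ)
insertFixed b w = place b (map (relabel (embed b)) w)

mask : List (ℕ × ℕ) → List Bool
mask [] = []
mask (x ∷ w) = not (isFixed (length w) x) ∷ mask w

NoFixed : List (ℕ × ℕ) → Set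
NoFixed w = falses (mask w) ≡ 0

length-mask : ∀ w → length (mask w) ≡ length w
length-mask [] = refl
length-mask (x ∷ w) = cong suc (length-mask w)

length-place : ∀ b {w} → length w ≡ trues b → length (place b w) ≡ length b
length-place [] _ = refl
length-place (true ∷ b) {x ∷ w} e = cong suc (length-place b (suc-injective e))
length-place (false ∷ b) e = cong suc (length-place b e)

place-↭ : ∀ b {w} → length w ≡ trues b → place b w ↭ w ++ map (_, 0) (skipped b)
place-↭ [] {[]} e = refl
place-↭ (true ∷ b) {x ∷ w} e = prep x (place-↭ b (suc-injective e))
place-↭ (false ∷ b) {w} e = ↭-trans (prep _ (place-↭ b e)) (↭-sym (Perm.shift _ w _))

place-injective : ∀ b {w w′} → length w ≡ trues b → length w′ ≡ trues b → place b w ≡ place b w′ → w ≡ w′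
place-injective [] {[]} {[]} _ _ _ = refl
place-injective (true ∷ b) {x ∷ w} {x′ ∷ w′} e e′ q with refl , q′ ← ∷-injective q =
  cong (x ∷_) (place-injective b (suc-injective e) (suc-injective e′) q′)
place-injective (false ∷ b) e e′ q = place-injective b e e′ (∷-injectiveʳ q)

unfixed : List (ℕ × ℕ) → List (ℕ × ℕ)
unfixed [] = []
unfixed (x ∷ w) = if isFixed (length w) x then unfixed w else x ∷ unfixed w

length-unfixed : ∀ w → length (unfixed w) ≡ trues (mask w)
length-unfixed [] = refl
length-unfixed (x ∷ w) with isFixed (length w) x
... | true = length-unfixed w
... | false = cong suc (length-unfixed w)

isFixed⇒≡ : ∀ p x → isFixed p x ≡ true → x ≡ (p , 0)
isFixed⇒≡ p (v , zero) e = cong (_, 0) (≡ᵇ⇒≡′ v p (trans (sym (∧-identityʳ _)) e))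
isFixed⇒≡ p (v , suc e) q with () ← trans (sym (∧-zeroʳ (v ≡ᵇ p))) q

isFixed-refl : ∀ p → isFixed p (p , 0) ≡ true
isFixed-refl p = trans (∧-identityʳ _) (≡ᵇ-true {p} refl)

place-unfixed : ∀ w → place (mask w) (unfixed w) ≡ w
place-unfixed [] = refl
place-unfixed (x ∷ w) with isFixed (length w) x in e
... | true = cong₂ _∷_ (trans (cong (_, 0) (length-mask w)) (sym (isFixed⇒≡ _ x e))) (place-unfixed w)
... | false = cong (x ∷_) (place-unfixed w)

-- The class of a letter at position p: excedances have rank 0, letters of colour e > 0
-- rank l ∸ e, and the remaining ones rank l.
rank : ℕ → ℕ → ℕ × ℕ → ℕ
rank l p (v , zero) = if p <ᵇ v then 0 else l
rank l p (v , suc e) = l ∸ suc e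

mark : ℕ → ℕ → ℕ × ℕ → Maybe (ℕ × ℕ)
mark l p x = if isFixed p x then nothing else just (proj₁ x , rank l p x)

mark-fixed : ∀ l {p x} → isFixed p x ≡ true → mark l p x ≡ nothing
mark-fixed l e rewrite e = refl

mark-unfixed : ∀ l {p x} → isFixed p x ≡ false → mark l p x ≡ just (proj₁ x , rank l p x)
mark-unfixed l e rewrite e = refl

marks : ℕ → List (ℕ × ℕ) → List (Maybe (ℕ × ℕ))
marks l [] = []
marks l (x ∷ w) = mark l (length w) x ∷ marks l w

keys : ℕ → List (ℕ × ℕ) → List (ℕ × ℕ)
keys l [] = []
keys l (x ∷ w) = (proj₁ x , rank l (length w) x) ∷ keys l w

length-keys : ∀ l w → length (keys l w) ≡ length w
length-keys l [] = refl
length-keys l (x ∷ w) = cong suc (length-keys l w)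

-- What is left of the outer bumps once an induction has descended to a final segment of the mask:
-- they move nothing below its length.
record FixesBelow (n : ℕ) (g : ℕ → ℕ) : Set where
  constructor fixesBelow
  field
    mono : StrictMono g
    fixes : ∀ {x} → x < n → g x ≡ x

open FixesBelow

fixesBelow-suc : ∀ {n g} → FixesBelow (suc n) g → FixesBelow n g
fixesBelow-suc h = fixesBelow (mono h) (fixes h ∘ m≤n⇒m≤1+n)

fixesBelow-bump : ∀ {n g} → FixesBelow (suc n) g → FixesBelow n (g ∘ bump n)
fixesBelow-bump {n} {g} h = fixesBelow (mono h ∘ bump-mono n)
  λ lt → trans (cong g (bump-< lt)) (fixes h (m≤n⇒m≤1+n lt))

-- In the following lemmas b is a final segment of the mask, that is, it describes the first
-- positions, and g ∘ embed b is the embedding belonging to the whole mask.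
module _ (g : ℕ → ℕ) (b : List Bool) (w : List (ℕ × ℕ)) (h : FixesBelow (suc (length b)) g)
  (e : length w ≡ trues b) where

  private
    f : ℕ → ℕ
    f = g ∘ embed b

    w′ : List (ℕ × ℕ)
    w′ = place b (map (relabel f) w)

    position : length w′ ≡ f (length w)
    position = trans (length-place b (trans (length-map _ w) e))
      (sym (trans (cong f e) (trans (cong g (embed-+-trues b 0)) (fixes h ≤-refl))))

    f-mono : StrictMono f
    f-mono = mono h ∘ embed-mono b

  isFixed-relabel : ∀ x → isFixed (length w′) (relabel f x) ≡ isFixed (length w) x
  isFixed-relabel (v , c) = cong (_∧ (c ≡ᵇ 0)) (trans (cong (f v ≡ᵇ_) position) (strictMono-≡ᵇ f-mono v (length w)))

  rank-relabel : ∀ l x → rank l (length w′) (relabel f x) ≡ rank l (length w) x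
  rank-relabel l (v , zero) = cong (if_then 0 else l) (trans (cong (_<ᵇ f v) position) (strictMono-<ᵇ f-mono (length w) v))
  rank-relabel l (v , suc c) = refl

NoFixed-∷ : ∀ {x w} → NoFixed (x ∷ w) → isFixed (length w) x ≡ false × NoFixed w
NoFixed-∷ {x} {w} nf with isFixed (length w) x
... | false = refl , nf

-- An inserted letter is a fixed point where it lands, hence `nothing`. An old letter keeps its rank
-- and does not become fixed, since its value and its position are moved by the same increasing map.
marks-place : ∀ l g b w → FixesBelow (length b) g → length w ≡ trues b → NoFixed w →
  marks l (place b (map (relabel (g ∘ embed b)) w)) ≡ shuffle b (map (relabel (g ∘ embed b)) (keys l w))
marks-place l g [] w h e nf = refl
marks-place l g (true ∷ b) (x ∷ w) h e nf with nf₁ , nf₂ ← NoFixed-∷ {x} {w} nf = cong₂ _∷_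
  (trans (mark-unfixed l {x = relabel (g ∘ embed b) x} (trans (isFixed-relabel g b w h e′ x) nf₁))
    (cong (λ r → just (g (embed b (proj₁ x)) , r)) (rank-relabel g b w h e′ l x)))
  (marks-place l g b w (fixesBelow-suc h) e′ nf₂)
  where
  e′ = suc-injective e
marks-place l g (false ∷ b) w h e nf = cong₂ _∷_
  (mark-fixed l {x = length b , 0} (trans (cong (λ p → isFixed p (length b , 0))
    (length-place b (trans (length-map _ w) e))) (isFixed-refl (length b))))
  (marks-place l (g ∘ bump (length b)) b w (fixesBelow-bump h) e nf)

mask-place : ∀ g b w → FixesBelow (length b) g → length w ≡ trues b → NoFixed w →
  mask (place b (map (relabel (g ∘ embed b)) w)) ≡ b
mask-place g [] w h e nf = refl
mask-place g (true ∷ b) (x ∷ w) h e nf with nf₁ , nf₂ ← NoFixed-∷ {x} {w} nf = cong₂ _∷_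
  (cong not (trans (isFixed-relabel g b w h (suc-injective e) x) nf₁))
  (mask-place g b w (fixesBelow-suc h) (suc-injective e) nf₂)
mask-place g (false ∷ b) w h e nf = cong₂ _∷_
  (cong not (trans (cong (λ p → isFixed p (length b , 0)) (length-place b (trans (length-map _ w) e))) (isFixed-refl (length b))))
  (mask-place (g ∘ bump (length b)) b w (fixesBelow-bump h) e nf)

mask-place⁻ : ∀ g b w → FixesBelow (length b) g → length w ≡ trues b →
  mask (place b (map (relabel (g ∘ embed b)) w)) ≡ b → NoFixed w
mask-place⁻ g [] [] h e m = refl
mask-place⁻ g (true ∷ b) (x ∷ w) h e m with m₁ , m₂ ← ∷-injective m
  rewrite trans (cong not (sym (isFixed-relabel g b w h (suc-injective e) x))) m₁ =
  mask-place⁻ g b w (fixesBelow-suc h) (suc-injective e) m₂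
mask-place⁻ g (false ∷ b) w h e m =
  mask-place⁻ (g ∘ bump (length b)) b w (fixesBelow-bump h) e (∷-injectiveʳ m)

fixesBelow-id : ∀ n → FixesBelow n id
fixesBelow-id n = fixesBelow id (λ _ → refl)

-- Coloured permutations decomposed by their fixed points

record ColouredPerm (l n : ℕ) (w : List (ℕ × ℕ)) : Set where
  constructor colouredPerm
  field
    length≡ : length w ≡ n
    bounded : All (λ (v , e) → v < n × e < l) w
    distinct : Unique (map proj₁ w)

open ColouredPerm

map-proj₁-relabel : ∀ f (w : List (ℕ × ℕ)) → map proj₁ (map (relabel f) w) ≡ map f (map proj₁ w)
map-proj₁-relabel f w = trans (sym (map-∘ w)) (map-∘ w)

map-proj₁-zero : ∀ (s : List ℕ) → map proj₁ (map (_, 0) s) ≡ s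
map-proj₁-zero s = trans (sym (map-∘ s)) (map-id s)

values-↭ : ∀ b w → length w ≡ trues b → map proj₁ (insertFixed b w) ↭ map (embed b) (map proj₁ w) ++ skipped b
values-↭ b w e = subst (map proj₁ (insertFixed b w) ↭_)
  (trans (map-++ proj₁ (map (relabel (embed b)) w) _) (cong₂ _++_ (map-proj₁-relabel (embed b) w) (map-proj₁-zero (skipped b))))
  (Perm.map⁺ proj₁ (place-↭ b (trans (length-map _ w) e)))

insertFixed-perm : ∀ {l} b {w} → 0 < l → ColouredPerm l (trues b) w → ColouredPerm l (length b) (insertFixed b w)
insertFixed-perm b {w} 0<l (colouredPerm e bd u) = colouredPerm
  (length-place b (trans (length-map _ w) e))
  (Perm.All-resp-↭ (↭-sym (place-↭ b (trans (length-map _ w) e)))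
    (AllP.++⁺ (AllP.map⁺ (All.map (λ (v<k , c<l) → embed-< b v<k , c<l) bd))
              (AllP.map⁺ (All.map (_, 0<l) (skipped-< b)))))
  (Unique-resp-↭ (↭-sym (values-↭ b w e)) (Uniq.++⁺ (Uniq.map⁺ (strictMono-injective (embed-mono b)) u)
    (skipped-unique b) disjoint))
  where
  disjoint : ∀ {v} → ¬ (v ∈ map (embed b) (map proj₁ w) × v ∈ skipped b)
  disjoint (p , q) with v , _ , refl ← ∈-map⁻ (embed b) p = embed-∉-skipped b v q

unrelabel : ∀ {l k f} xs → All (λ (v , e) → (∃ λ i → i < k × f i ≡ v) × e < l) xs →
  ∃ λ w → map (relabel f) w ≡ xs × All (λ (v , e) → v < k × e < l) w
unrelabel [] [] = [] , refl , []
unrelabel (_ ∷ xs) (((i , i<k , refl) , c<l) ∷ a) with w , refl , bd ← unrelabel xs a = (i , _) ∷ w , refl , (i<k , c<l) ∷ bd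

unique-++⁻ : ∀ {A : Set} (xs : List A) {ys} → Unique (xs ++ ys) → Unique xs × (∀ {x} → x ∈ xs → x ∉ ys)
unique-++⁻ [] u = [] , λ ()
unique-++⁻ (x ∷ xs) {ys} (x∉ ∷ u) with u′ , d ← unique-++⁻ xs u = AllP.++⁻ˡ xs x∉ ∷ u′ ,
  λ { (here refl) p → All.lookup (AllP.++⁻ʳ xs x∉) p refl ; (there q) → d q }

-- By distinctness no remaining letter has the value of a removed fixed point, so all remaining
-- values lie in the image of `embed` and can be pulled back.
removeFixed : ∀ {l n w} → ColouredPerm l n w →
  ∃ λ w′ → ColouredPerm l (trues (mask w)) w′ × NoFixed w′ × insertFixed (mask w) w′ ≡ w
removeFixed {l} {n} {w} (colouredPerm refl bd u) = go (unrelabel (unfixed w) preimages)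
  where
  b = mask w
  w↭ : w ↭ unfixed w ++ map (_, 0) (skipped b)
  w↭ = subst (_↭ unfixed w ++ map (_, 0) (skipped b)) (place-unfixed w) (place-↭ b (length-unfixed w))
  values : Unique (map proj₁ (unfixed w) ++ skipped b)
  values = subst Unique (trans (map-++ proj₁ (unfixed w) _) (cong (map proj₁ (unfixed w) ++_) (map-proj₁-zero (skipped b))))
    (Unique-resp-↭ (Perm.map⁺ proj₁ w↭) u)
  preimage : ∀ {x} → x ∈ unfixed w → proj₁ x < length w × proj₂ x < l →
    (∃ λ i → i < trues b × embed b i ≡ proj₁ x) × proj₂ x < l
  preimage {x} p (v<n , c<l) with embed-or-skipped b (subst (proj₁ x <_) (sym (length-mask w)) v<n)
  ... | inj₁ i = i , c<l
  ... | inj₂ s = contradiction s (proj₂ (unique-++⁻ _ values) (∈-map⁺ proj₁ p))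
  preimages : All (λ (v , e) → (∃ λ i → i < trues b × embed b i ≡ v) × e < l) (unfixed w)
  preimages = All.tabulate λ p → preimage p (All.lookup (AllP.++⁻ˡ (unfixed w) (Perm.All-resp-↭ w↭ bd)) p)
  go : ∃ (λ w′ → map (relabel (embed b)) w′ ≡ unfixed w × All (λ (v , e) → v < trues b × e < l) w′) →
    ∃ λ w′ → ColouredPerm l (trues b) w′ × NoFixed w′ × insertFixed b w′ ≡ w
  go (w′ , eq , bd′) = w′ , colouredPerm len bd′ (Uniq.map⁻ (subst Unique (trans (cong (map proj₁) (sym eq))
      (map-proj₁-relabel (embed b) w′)) (proj₁ (unique-++⁻ _ values)))) ,
      mask-place⁻ id b w′ (fixesBelow-id _) len (cong mask ins) , ins
    where
    len : length w′ ≡ trues b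
    len = trans (trans (sym (length-map _ w′)) (cong length eq)) (length-unfixed w)
    ins : insertFixed b w′ ≡ w
    ins = trans (cong (place b) eq) (place-unfixed w)

unique-map-∈ : ∀ {A B : Set} (f : A → B) {xs} → (∀ {x y} → x ∈ xs → y ∈ xs → f x ≡ f y → x ≡ y) → Unique xs → Unique (map f xs)
unique-map-∈ f inj [] = []
unique-map-∈ f {x ∷ xs} inj (x∉ ∷ u) =
  AllP.map⁺ (All.tabulate λ p e → All.lookup x∉ p (inj (here refl) (there p) e))
  ∷ unique-map-∈ f (λ p q → inj (there p) (there q)) u

gtKey : ℕ × ℕ → ℕ × ℕ → Bool
gtKey (v , r) (v′ , r′) = (r′ <ᵇ r) ∨ ((r′ ≡ᵇ r) ∧ (v′ <ᵇ v))

-- An excedance weighs l, a letter of colour e > 0 weighs e and any other letter 0, which add up to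
-- `fexc`.
weight : ℕ → ℕ × ℕ → ℕ
weight l (_ , r) = l ∸ r

tStat qStat : ℕ → List (ℕ × ℕ) → ℕ
tStat l w = ∑ (keys l w) (weight l)
qStat l w = majBy gtKey (keys l w)

tStatᵐ : ℕ → List (ℕ × ℕ) → ℕ
tStatᵐ l w = ∑ (marks l w) (Maybe.maybe′ (weight l) 0)

fixedPoints : List (ℕ × ℕ) → ℕ
fixedPoints w = falses (mask w)

qStatᵐ : Bool → ℕ → List (ℕ × ℕ) → ℕ
qStatᵐ s l w = majBy (extend s gtKey) (marks l w)

majBy-map : ∀ {X Y : Set} {gt : X → X → Bool} {gt′ : Y → Y → Bool} (h : Y → X) →
  (∀ x y → gt (h x) (h y) ≡ gt′ x y) → ∀ w → majBy gt (map h w) ≡ majBy gt′ w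
majBy-map h eq [] = refl
majBy-map h eq (x ∷ []) = refl
majBy-map h eq (x ∷ y ∷ w) = cong₂ _+_
  (cong₂ (λ b n → if b then suc n else 0) (eq y x) (length-map h w)) (majBy-map h eq (y ∷ w))

shuffle-map : ∀ {X Y : Set} (h : X → Y) b u → shuffle b (map h u) ≡ map (Maybe.map h) (shuffle b u)
shuffle-map h [] u = refl
shuffle-map h (false ∷ b) u = cong (nothing ∷_) (shuffle-map h b u)
shuffle-map h (true ∷ b) [] = refl
shuffle-map h (true ∷ b) (x ∷ u) = cong (just (h x) ∷_) (shuffle-map h b u)

∑-shuffle : ∀ {X : Set} (h : X → ℕ) b u → length u ≡ trues b → ∑ (shuffle b u) (Maybe.maybe′ h 0) ≡ ∑ u h
∑-shuffle h [] [] e = refl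
∑-shuffle h (false ∷ b) u e = ∑-shuffle h b u e
∑-shuffle h (true ∷ b) (x ∷ u) e = cong (h x +_) (∑-shuffle h b u (suc-injective e))

∑-shuffles : ∀ {X : Set} (gt : X → X → Bool) s u j (ψ : ℕ → ℕ) →
  ∑ (masks (length u) j) (λ b → ψ (majBy (extend s gt) (shuffle b u)))
  ≡ ∑ (gauss (length u) j) (λ c → ψ (majBy gt u + c))
∑-shuffles gt true = ∑-maj∞ gt
∑-shuffles gt false = ∑-maj-∞ gt

module _ {b w} (l : ℕ) (e : length w ≡ trues b) (nf : NoFixed w) where

  private
    f = embed b

    marks-insert : marks l (insertFixed b w) ≡ map (Maybe.map (relabel f)) (shuffle b (keys l w))
    marks-insert = trans (marks-place l id b w (fixesBelow-id _) e nf) (shuffle-map (relabel f) b (keys l w))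

    gtKey-relabel : ∀ s x y → extend s gtKey (Maybe.map (relabel f) x) (Maybe.map (relabel f) y) ≡ extend s gtKey x y
    gtKey-relabel s nothing nothing = refl
    gtKey-relabel s nothing (just _) = refl
    gtKey-relabel s (just _) nothing = refl
    gtKey-relabel s (just (v , r)) (just (v′ , r′)) =
      cong (λ b → (r′ <ᵇ r) ∨ ((r′ ≡ᵇ r) ∧ b)) (strictMono-<ᵇ (embed-mono b) v′ v)

    weight-relabel : ∀ x → Maybe.maybe′ (weight l) 0 (Maybe.map (relabel f) x) ≡ Maybe.maybe′ (weight l) 0 x
    weight-relabel (just _) = refl
    weight-relabel nothing = refl

  qStatᵐ-insert : ∀ s → qStatᵐ s l (insertFixed b w) ≡ majBy (extend s gtKey) (shuffle b (keys l w))
  qStatᵐ-insert s = trans (cong (majBy (extend s gtKey)) marks-insert)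
    (majBy-map (Maybe.map (relabel f)) (gtKey-relabel s) (shuffle b (keys l w)))

  tStatᵐ-insert : tStatᵐ l (insertFixed b w) ≡ tStat l w
  tStatᵐ-insert = trans (cong (λ m → ∑ m (Maybe.maybe′ (weight l) 0)) marks-insert)
    (trans (∑-map (Maybe.map (relabel f)) (shuffle b (keys l w))) (trans (∑-cong (shuffle b (keys l w)) weight-relabel)
      (∑-shuffle (weight l) b (keys l w) (trans (length-keys l w) e))))

  fixedPoints-insert : fixedPoints (insertFixed b w) ≡ falses b
  fixedPoints-insert = cong falses (mask-place id b w (fixesBelow-id _) e nf)

module _ {l : ℕ} (0<l : 0 < l) (P : ℕ → List (List (ℕ × ℕ))) (P-unique : ∀ n → Unique (P n))
  (P-sound : ∀ {n w} → w ∈ P n → ColouredPerm l n w) (P-complete : ∀ {n w} → ColouredPerm l n w → w ∈ P n) where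

  private
    noFixed? : ∀ w → Dec (NoFixed w)
    noFixed? w = falses (mask w) ≟ 0

  derangements : ℕ → List (List (ℕ × ℕ))
  derangements n = filter noFixed? (P n)

  private
    allMasks : ℕ → List (List Bool)
    allMasks n = concatMap (λ (k , j) → masks k j) (antidiagonal n)

    fromMask : List Bool → List (List (ℕ × ℕ))
    fromMask b = map (insertFixed b) (derangements (trues b))

    allMasks-unique : ∀ n → Unique (allMasks n)
    allMasks-unique n = unique-concatMap _ (λ b → trues b , falses b) (antidiagonal-unique n)
      (λ {(k , j)} _ → masks-unique k j) (λ {(k , j)} _ → masks-counts k j)

    ∈-derangements : ∀ {k w} → w ∈ derangements k → ColouredPerm l k w × NoFixed w
    ∈-derangements {k} p with q , nf ← ∈-filter⁻ noFixed? {xs = P k} p = P-sound q , nf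

    fromMask-unique : ∀ b → Unique (fromMask b)
    fromMask-unique b = unique-map-∈ (insertFixed b) injective (Uniq.filter⁺ noFixed? (P-unique (trues b)))
      where
      len : ∀ {w} → w ∈ derangements (trues b) → length (map (relabel (embed b)) w) ≡ trues b
      len {w} p = trans (length-map _ w) (length≡ (proj₁ (∈-derangements p)))
      injective : ∀ {w w′} → w ∈ derangements (trues b) → w′ ∈ derangements (trues b) →
        insertFixed b w ≡ insertFixed b w′ → w ≡ w′
      injective p q e = map-injective
        (λ e → cong₂ _,_ (strictMono-injective (embed-mono b) (cong proj₁ e)) (cong proj₂ e))
        (place-injective b (len p) (len q) e)

    ∈-allMasks⁺ : ∀ b → b ∈ allMasks (length b)
    ∈-allMasks⁺ b = ∈-concatMap⁺ _ (lose (subst (λ n → (trues b , falses b) ∈ antidiagonal n) (trues+falses b)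
      (∈-antidiagonal⁺ (trues b) (falses b))) (∈-masks b))

    ∈-allMasks⁻ : ∀ {n b} → b ∈ allMasks n → length b ≡ n
    ∈-allMasks⁻ {n} {b} p with (k , j) , q , r ← find (∈-concatMap⁻ _ {xs = antidiagonal n} p) =
      trans (sym (trues+falses b)) (trans (cong (λ (k , j) → k + j) (masks-counts k j r)) (∈-antidiagonal n q))

    decomposition : ∀ n → P n ↭ concatMap fromMask (allMasks n)
    decomposition n = unique-⊆⊇⇒↭ (P-unique n)
      (unique-concatMap fromMask mask (allMasks-unique n) (λ {b} _ → fromMask-unique b) recover) into onto
      where
      recover : ∀ {b w} → b ∈ allMasks n → w ∈ fromMask b → mask w ≡ b
      recover {b} _ p with w , q , refl ← ∈-map⁻ (insertFixed b) p with cp , nf ← ∈-derangements q =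
        mask-place id b w (fixesBelow-id _) (length≡ cp) nf
      into : ∀ {w} → w ∈ P n → w ∈ concatMap fromMask (allMasks n)
      into {w} p with cp ← P-sound p with w′ , cp′ , nf , eq ← removeFixed cp =
        ∈-concatMap⁺ fromMask (lose (subst (λ n → mask w ∈ allMasks n) (trans (length-mask w) (length≡ cp)) (∈-allMasks⁺ (mask w)))
          (subst (_∈ fromMask (mask w)) eq (∈-map⁺ (insertFixed (mask w)) (∈-filter⁺ noFixed? (P-complete cp′) nf))))
      onto : ∀ {w} → w ∈ concatMap fromMask (allMasks n) → w ∈ P n
      onto p with b , q , r ← find (∈-concatMap⁻ fromMask {xs = allMasks n} p) with w , t , refl ← ∈-map⁻ (insertFixed b) r =
        P-complete (subst (λ n → ColouredPerm l n _) (∈-allMasks⁻ q) (insertFixed-perm b 0<l (proj₁ (∈-derangements t))))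

  -- The fixed points of a coloured permutation can be treated as largest letters (s = true)
  -- as well as smallest ones (s = false).
  ∑-P : ∀ s n (φ : ℕ → Test) →
    ∑ (P n) (λ w → φ (fixedPoints w) (tStatᵐ l w) (qStatᵐ s l w))
    ≡ ∑ (antidiagonal n) (λ (k , j) → gaussian (tStat l) (qStat l) derangements (k , j) (φ j))
  ∑-P s n φ = begin
    ∑ (P n) Φ
      ≡⟨ ∑-↭ (decomposition n) ⟩
    ∑ (concatMap fromMask (allMasks n)) Φ
      ≡⟨ ∑-concatMap fromMask (allMasks n) ⟩
    ∑ (allMasks n) (λ b → ∑ (fromMask b) Φ)
      ≡⟨ ∑-concatMap (λ (k , j) → masks k j) (antidiagonal n) ⟩
    ∑ (antidiagonal n) (λ (k , j) → ∑ (masks k j) (λ b → ∑ (fromMask b) Φ))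
      ≡⟨ ∑-cong (antidiagonal n) (λ (k , j) → block k j) ⟩
    ∑ (antidiagonal n) (λ (k , j) → gaussian (tStat l) (qStat l) derangements (k , j) (φ j)) ∎
    where
    open ≡-Reasoning
    Φ : List (ℕ × ℕ) → ℕ
    Φ w = φ (fixedPoints w) (tStatᵐ l w) (qStatᵐ s l w)
    shuffled : List (ℕ × ℕ) → List Bool → ℕ
    shuffled w b = majBy (extend s gtKey) (shuffle b (keys l w))
    inserted : ∀ k j {b} → b ∈ masks k j → ∑ (fromMask b) Φ ≡ ∑ (derangements k) (λ w → φ j (tStat l w) (shuffled w b))
    inserted k j {b} p with refl ← masks-counts k j p = trans (∑-map (insertFixed b) (derangements k))
      (∑-cong∈ (derangements k) λ {w} q → let cp , nf = ∈-derangements q; e = length≡ cp in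
        trans (cong₂ (λ i t → φ i t (qStatᵐ s l (insertFixed b w))) (fixedPoints-insert {b} l e nf) (tStatᵐ-insert {b} l e nf))
              (cong (φ j (tStat l w)) (qStatᵐ-insert {b} l e nf s)))
    block : ∀ k j → ∑ (masks k j) (λ b → ∑ (fromMask b) Φ) ≡ gaussian (tStat l) (qStat l) derangements (k , j) (φ j)
    block k j = begin
      ∑ (masks k j) (λ b → ∑ (fromMask b) Φ)
        ≡⟨ ∑-cong∈ (masks k j) (inserted k j) ⟩
      ∑ (masks k j) (λ b → ∑ (derangements k) (λ w → φ j (tStat l w) (shuffled w b)))
        ≡⟨ ∑-swap (masks k j) (derangements k) ⟩
      ∑ (derangements k) (λ w → ∑ (masks k j) (λ b → φ j (tStat l w) (shuffled w b)))
        ≡⟨ ∑-cong∈ (derangements k) (λ {w} q →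
             subst (λ k → ∑ (masks k j) (λ b → φ j (tStat l w) (shuffled w b)) ≡ ∑ (gauss k j) (λ c → φ j (tStat l w) (qStat l w + c)))
               (trans (length-keys l w) (length≡ (proj₁ (∈-derangements q))))
               (∑-shuffles gtKey s (keys l w) j (φ j (tStat l w)))) ⟩
      ∑ (derangements k) (λ w → ∑ (gauss k j) (λ c → φ j (tStat l w) (qStat l w + c)))
        ≡⟨ ∑-swap (derangements k) (gauss k j) ⟩
      gaussian (tStat l) (qStat l) derangements (k , j) (φ j) ∎

-- Fixed points as largest and as smallest letters

gtKey-true : ∀ v r v′ r′ → r′ < r ⊎ (r′ ≡ r × v′ < v) → gtKey (v , r) (v′ , r′) ≡ true
gtKey-true v r v′ r′ (inj₁ lt) rewrite <ᵇ-true lt = refl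
gtKey-true v r v′ r′ (inj₂ (refl , lt)) rewrite <ᵇ-false {r} {r} ≤-refl | ≡ᵇ-true {r} refl | <ᵇ-true lt = refl

gtKey-false : ∀ v r v′ r′ → r < r′ ⊎ (r′ ≡ r × v ≤ v′) → gtKey (v , r) (v′ , r′) ≡ false
gtKey-false v r v′ r′ (inj₁ lt) rewrite <ᵇ-false (<⇒≤ lt) | ≡ᵇ-false (>⇒≢ lt) = refl
gtKey-false v r v′ r′ (inj₂ (refl , le)) rewrite <ᵇ-false {r} {r} ≤-refl | ≡ᵇ-true {r} refl | <ᵇ-false le = refl

block-< : ∀ {r r′ n v} v′ → v < n → r < r′ → r * n + v < r′ * n + v′
block-< {r} {r′} {n} {v} v′ v<n r<r′ = begin-strict
  r * n + v   <⟨ +-monoʳ-< (r * n) v<n ⟩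
  r * n + n   ≡⟨ +-comm (r * n) n ⟩
  suc r * n   ≤⟨ *-monoˡ-≤ n r<r′ ⟩
  r′ * n      ≤⟨ m≤m+n (r′ * n) v′ ⟩
  r′ * n + v′ ∎
  where open ≤-Reasoning

+-<ᵇ : ∀ c a b → (c + a <ᵇ c + b) ≡ (a <ᵇ b)
+-<ᵇ zero a b = refl
+-<ᵇ (suc c) a b = +-<ᵇ c a b

-- Since values are below n, the code is an expansion in base n and its order is lexicographic.
-- Rotation becomes subtraction of 1 on codes.
gtKey-code : ∀ {n v} r {v′} r′ → v < n → v′ < n → (r′ * n + v′ <ᵇ r * n + v) ≡ gtKey (v , r) (v′ , r′)
gtKey-code {n} {v} r {v′} r′ v<n v′<n with <-cmp r′ r
... | tri< lt _ _ = trans (<ᵇ-true (block-< v v′<n lt)) (sym (gtKey-true v r v′ r′ (inj₁ lt)))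
... | tri> _ _ gt = trans (<ᵇ-false (<⇒≤ (block-< v′ v<n gt))) (sym (gtKey-false v r v′ r′ (inj₁ gt)))
... | tri≈ _ refl _ = trans (+-<ᵇ (r * n) v′ v) (sym same)
  where
  same : gtKey (v , r) (v′ , r) ≡ (v′ <ᵇ v)
  same rewrite <ᵇ-false {r} {r} ≤-refl | ≡ᵇ-true {r} refl = refl

gtℕ : ℕ → ℕ → Bool
gtℕ y x = x <ᵇ y

codes : (ℕ → ℕ × ℕ → ℕ) → ℕ → List (ℕ × ℕ) → List ℕ
codes R n [] = []
codes R n (x ∷ w) = R (length w) x * n + proj₁ x ∷ codes R n w

length-codes : ∀ R n w → length (codes R n w) ≡ length w
length-codes R n [] = refl
length-codes R n (x ∷ w) = cong suc (length-codes R n w)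

weights : ℕ → (ℕ → ℕ × ℕ → ℕ) → List (ℕ × ℕ) → ℕ
weights l R [] = 0
weights l R (x ∷ w) = l ∸ R (length w) x + weights l R w

-- Like rank, but a fixed point of colour 0 is counted as an excedance.
rank′ : ℕ → ℕ → ℕ × ℕ → ℕ
rank′ l p (v , zero) = if p <ᵇ suc v then 0 else l
rank′ l p (v , suc e) = l ∸ suc e

rank-> : ∀ l {p v} → p < v → rank l p (v , 0) ≡ 0
rank-> l p<v rewrite <ᵇ-true p<v = refl

rank-≤ : ∀ l {p v} → v ≤ p → rank l p (v , 0) ≡ l
rank-≤ l v≤p rewrite <ᵇ-false v≤p = refl

rank′-≥ : ∀ l {p v} → p ≤ v → rank′ l p (v , 0) ≡ 0
rank′-≥ l p≤v rewrite <ᵇ-true (s≤s p≤v) = refl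

rank′-< : ∀ l {p v} → v < p → rank′ l p (v , 0) ≡ l
rank′-< l v<p rewrite <ᵇ-false v<p = refl

isFixed-false : ∀ {p v} → isFixed p (v , 0) ≡ false → v ≢ p
isFixed-false {p} nf refl with () ← trans (sym nf) (isFixed-refl p)

rank′≡rank : ∀ l p x → isFixed p x ≡ false → rank′ l p x ≡ rank l p x
rank′≡rank l p (v , suc e) nf = refl
rank′≡rank l p (v , zero) nf with <-cmp p v
... | tri< lt _ _ = trans (rank′-≥ l (<⇒≤ lt)) (sym (rank-> l lt))
... | tri≈ _ eq _ = contradiction (sym eq) (isFixed-false nf)
... | tri> _ _ gt = trans (rank′-< l gt) (sym (rank-≤ l (<⇒≤ gt)))

module _ (l′ n : ℕ) where

  private
    l = suc l′

  Bounded : ℕ × ℕ → Set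
  Bounded (v , e) = v < n × e < l

  module _ (p : ℕ) where

    -- A fixed point of rank l need not be the largest letter of that rank, but beside its
    -- neighbours it acts as such: an unfixed letter of rank l at position p + 1 has value at most
    -- p, and p is already taken.
    fixed-above : ∀ x → isFixed (suc p) x ≡ false → proj₁ x ≢ p → Bounded x →
      gtKey (p , rank l p (p , 0)) (proj₁ x , rank l (suc p) x) ≡ true
    fixed-above (v , suc e) nf v≢p (_ , s≤s e<l′) rewrite rank-≤ l {p} ≤-refl = gtKey-true p l v (l′ ∸ e) (inj₁ (s≤s (m∸n≤m l′ e)))
    fixed-above (v , zero) nf v≢p _ with <-cmp (suc p) v
    ... | tri< lt _ _ rewrite rank-≤ l {p} ≤-refl | rank-> l lt = gtKey-true p l v 0 (inj₁ z<s)
    ... | tri≈ _ eq _ = contradiction (sym eq) (isFixed-false nf)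
    ... | tri> _ _ (s≤s v≤p) rewrite rank-≤ l {p} ≤-refl | rank-≤ l (m≤n⇒m≤1+n v≤p) =
      gtKey-true p l v l (inj₂ (refl , ≤∧≢⇒< v≤p v≢p))

    not-above-fixed : ∀ y → gtKey (proj₁ y , rank l p y) (suc p , rank l (suc p) (suc p , 0)) ≡ false
    not-above-fixed (v , suc e) rewrite rank-≤ l {suc p} ≤-refl = gtKey-false v (l′ ∸ e) (suc p) l (inj₁ (s≤s (m∸n≤m l′ e)))
    not-above-fixed (v , zero) with p <? v
    ... | yes lt rewrite rank-≤ l {suc p} ≤-refl | rank-> l lt = gtKey-false v 0 (suc p) l (inj₁ z<s)
    ... | no ≮ rewrite rank-≤ l {suc p} ≤-refl | rank-≤ l (≮⇒≥ ≮) = gtKey-false v l (suc p) l (inj₂ (refl , m≤n⇒m≤1+n (≮⇒≥ ≮)))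

    not-fixed-above : ∀ x → Bounded x → gtKey (p , rank′ l p (p , 0)) (proj₁ x , rank′ l (suc p) x) ≡ false
    not-fixed-above (v , suc e) (_ , s≤s e<l′) rewrite rank′-≥ l {p} ≤-refl = gtKey-false p 0 v (l′ ∸ e) (inj₁ (m<n⇒0<n∸m e<l′))
    not-fixed-above (v , zero) _ with suc p ≤? v
    ... | yes le rewrite rank′-≥ l {p} ≤-refl | rank′-≥ l le = gtKey-false p 0 v 0 (inj₂ (refl , <⇒≤ le))
    ... | no ≰ rewrite rank′-≥ l {p} ≤-refl | rank′-< l (≰⇒> ≰) = gtKey-false p 0 v l (inj₁ z<s)

    -- An unfixed letter of rank 0 at position p has value above p, and p + 1 belongs to the fixed
    -- point that follows; so next to its neighbours the latter acts as a smallest letter.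
    above-fixed : ∀ y → isFixed p y ≡ false → proj₁ y ≢ suc p → Bounded y →
      gtKey (proj₁ y , rank′ l p y) (suc p , rank′ l (suc p) (suc p , 0)) ≡ true
    above-fixed (v , suc e) nf v≢ (_ , s≤s e<l′) rewrite rank′-≥ l {suc p} ≤-refl = gtKey-true v (l′ ∸ e) (suc p) 0 (inj₁ (m<n⇒0<n∸m e<l′))
    above-fixed (v , zero) nf v≢ _ with p ≤? v
    ... | yes le rewrite rank′-≥ l {suc p} ≤-refl | rank′-≥ l le =
      gtKey-true v 0 (suc p) 0 (inj₂ (refl , ≤∧≢⇒< (≤∧≢⇒< le (isFixed-false nf ∘ sym)) (v≢ ∘ sym)))
    ... | no ≰ rewrite rank′-≥ l {suc p} ≤-refl | rank′-< l (≰⇒> ≰) = gtKey-true v l (suc p) 0 (inj₁ z<s)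

    module _ {x y : ℕ × ℕ} (x≢y : proj₁ x ≢ proj₁ y) (bx : Bounded x) (by : Bounded y) where

      gtKey-mark : gtKey (proj₁ y , rank l p y) (proj₁ x , rank l (suc p) x) ≡ extend true gtKey (mark l p y) (mark l (suc p) x)
      gtKey-mark with isFixed p y in ey | isFixed (suc p) x in ex
      ... | false | false = refl
      ... | true | false with refl ← isFixed⇒≡ p y ey = fixed-above x ex x≢y bx
      ... | false | true with refl ← isFixed⇒≡ (suc p) x ex = not-above-fixed y
      ... | true | true with refl ← isFixed⇒≡ (suc p) x ex = not-above-fixed y

      gtKey-mark′ : gtKey (proj₁ y , rank′ l p y) (proj₁ x , rank′ l (suc p) x) ≡ extend false gtKey (mark l p y) (mark l (suc p) x)
      gtKey-mark′ with isFixed p y in ey | isFixed (suc p) x in ex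
      ... | false | false rewrite rank′≡rank l p y ey | rank′≡rank l (suc p) x ex = refl
      ... | true | false with refl ← isFixed⇒≡ p y ey = not-fixed-above x bx
      ... | false | true with refl ← isFixed⇒≡ (suc p) x ex = above-fixed y ey (x≢y ∘ sym) by
      ... | true | true with refl ← isFixed⇒≡ p y ey = not-fixed-above x bx

  majBy-codes : ∀ R s → (∀ p {x y} → proj₁ x ≢ proj₁ y → Bounded x → Bounded y →
      gtKey (proj₁ y , R p y) (proj₁ x , R (suc p) x) ≡ extend s gtKey (mark l p y) (mark l (suc p) x)) →
    ∀ {w} → All Bounded w → Unique (map proj₁ w) → majBy gtℕ (codes R n w) ≡ qStatᵐ s l w
  majBy-codes R s h {[]} _ _ = refl
  majBy-codes R s h {x ∷ []} _ _ = refl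
  majBy-codes R s h {x ∷ y ∷ w} (bx ∷ by ∷ bw) ((x≢y ∷ _) ∷ u) = cong₂ _+_
    (cong₂ (λ b i → if b then suc i else 0)
      (trans (gtKey-code (R (length w) y) (R (suc (length w)) x) (proj₁ by) (proj₁ bx)) (h (length w) x≢y bx by))
      (trans (length-codes R n w) (sym (length-marks w))))
    (majBy-codes R s h (by ∷ bw) u)
    where
    length-marks : ∀ w → length (marks l w) ≡ length w
    length-marks [] = refl
    length-marks (x ∷ w) = cong suc (length-marks w)

  majBy-codes-rank : ∀ {w} → All Bounded w → Unique (map proj₁ w) → majBy gtℕ (codes (rank l) n w) ≡ qStatᵐ true l w
  majBy-codes-rank = majBy-codes (rank l) true gtKey-mark

  majBy-codes-rank′ : ∀ {w} → All Bounded w → Unique (map proj₁ w) → majBy gtℕ (codes (rank′ l) n w) ≡ qStatᵐ false l w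
  majBy-codes-rank′ = majBy-codes (rank′ l) false gtKey-mark′

weights-rank : ∀ l w → weights l (rank l) w ≡ tStatᵐ l w
weights-rank l [] = refl
weights-rank l (x ∷ w) with isFixed (length w) x in e
... | false = cong₂ _+_ refl (weights-rank l w)
... | true with refl ← isFixed⇒≡ (length w) x e = cong₂ _+_
  (trans (cong (l ∸_) (rank-≤ l {length w} ≤-refl)) (n∸n≡0 l)) (weights-rank l w)

weights-rank′ : ∀ l w → weights l (rank′ l) w ≡ tStatᵐ l w + l * fixedPoints w
weights-rank′ l [] = sym (*-zeroʳ l)
weights-rank′ l (x ∷ w) with isFixed (length w) x in e
... | false = trans (cong₂ _+_ (cong (l ∸_) (rank′≡rank l _ x e)) (weights-rank′ l w)) (sym (+-assoc (l ∸ rank l (length w) x) _ _))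
... | true with refl ← isFixed⇒≡ (length w) x e = trans
  (cong₂ _+_ (cong (l ∸_) (rank′-≥ l {length w} ≤-refl)) (weights-rank′ l w)) (arith l (tStatᵐ l w) (fixedPoints w))
  where
  arith : ∀ l t f → l + (t + l * f) ≡ t + l * suc f
  arith = solve-∀

-- Rotation

module _ (l′ n′ : ℕ) where

  private
    l = suc l′
    n = suc n′

    predᶜ : ℕ → ℕ
    predᶜ zero = n′
    predᶜ (suc v) = v

    -- For a letter of value 0, raising the colour lowers the rank by 1. Colour l - 1 has rank 1
    -- there and wraps around to colour 0: together with the new value n - 1 this is a weak
    -- excedance at every position, hence of rank 0.
    sucᶜ : ℕ → ℕ
    sucᶜ e = if e ≡ᵇ l′ then 0 else suc e

    predᶜ-injective : ∀ {v v′} → v < n → v′ < n → predᶜ v ≡ predᶜ v′ → v ≡ v′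
    predᶜ-injective {zero} {zero} _ _ _ = refl
    predᶜ-injective {zero} {suc v′} _ (s≤s lt) e = contradiction (sym e) (<⇒≢ lt)
    predᶜ-injective {suc v} {zero} (s≤s lt) _ e = contradiction e (<⇒≢ lt)
    predᶜ-injective {suc v} {suc v′} _ _ e = cong suc e

    sucᶜ-< : ∀ {e} → e < l → sucᶜ e < l
    sucᶜ-< {e} (s≤s e≤l′) with e ≟ l′
    ... | yes eq rewrite ≡ᵇ-true eq = z<s
    ... | no ne rewrite ≡ᵇ-false ne = s≤s (≤∧≢⇒< e≤l′ ne)

    sucᶜ-injective : ∀ e e′ → sucᶜ e ≡ sucᶜ e′ → e ≡ e′
    sucᶜ-injective e e′ q with e ≟ l′ | e′ ≟ l′
    ... | yes eq | yes eq′ = trans eq (sym eq′)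
    ... | no ne | no ne′ rewrite ≡ᵇ-false ne | ≡ᵇ-false ne′ = suc-injective q
    ... | yes eq | no ne′ rewrite ≡ᵇ-true eq | ≡ᵇ-false ne′ with () ← q
    ... | no ne | yes eq′ rewrite ≡ᵇ-false ne | ≡ᵇ-true eq′ with () ← q

  -- The predecessor map of the order of codes: the least letter of each class goes to the
  -- greatest letter of the preceding one.
  rotate : ℕ × ℕ → ℕ × ℕ
  rotate (zero , e) = n′ , sucᶜ e
  rotate (suc v , e) = v , e

  private
    proj₁-rotate : ∀ x → proj₁ (rotate x) ≡ predᶜ (proj₁ x)
    proj₁-rotate (zero , e) = refl
    proj₁-rotate (suc v , e) = refl

    rotate-bounded : ∀ {x} → Bounded l′ n x → Bounded l′ n (rotate x)
    rotate-bounded {zero , e} (_ , lt) = ≤-refl , sucᶜ-< lt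
    rotate-bounded {suc v , e} (lt , lt′) = <⇒≤ lt , lt′

    rotate-injective : ∀ {x x′} → Bounded l′ n x → Bounded l′ n x′ → rotate x ≡ rotate x′ → x ≡ x′
    rotate-injective {x} {x′} (lt , _) (lt′ , _) eq
      with predᶜ-injective lt lt′ (trans (sym (proj₁-rotate x)) (trans (cong proj₁ eq) (proj₁-rotate x′)))
    rotate-injective {zero , e} {zero , e′} _ _ eq | refl = cong (zero ,_) (sucᶜ-injective e e′ (cong proj₂ eq))
    rotate-injective {suc v , e} {suc v , e′} _ _ eq | refl = cong (suc v ,_) (cong proj₂ eq)

    -- For a positive value v + 1 of colour 0, `rank` tests `p <ᵇ suc v`, which is literally the
    -- test in `rank′` for v; this is the origin of `rank′`. All the work is in the value 0.
    rotate-rank : ∀ p → p < n → ∀ x → Bounded l′ n x →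
      rank l p x ≡ 𝟙 (proj₁ x ≡ᵇ 0) + rank′ l p (rotate x)
    rotate-rank p p<n (suc v , zero) _ = refl
    rotate-rank p p<n (suc v , suc e) _ = refl
    rotate-rank p (s≤s p≤n′) (zero , e) (_ , s≤s e≤l′) with e ≟ l′
    rotate-rank p (s≤s p≤n′) (zero , zero) _ | yes refl rewrite rank′-≥ 1 p≤n′ = refl
    rotate-rank p (s≤s p≤n′) (zero , suc e) _ | yes refl rewrite ≡ᵇ-true {e} refl | rank′-≥ (2 + e) p≤n′ = m+n∸n≡m 1 e
    rotate-rank p (s≤s p≤n′) (zero , zero) _ | no ne rewrite ≡ᵇ-false ne = refl
    rotate-rank p (s≤s p≤n′) (zero , suc e) (_ , s≤s e≤l′) | no ne rewrite ≡ᵇ-false ne =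
      +-∸-assoc 1 e≤l′

    rotate-code : ∀ p → p < n → ∀ x → Bounded l′ n x →
      rank l p x * n + proj₁ x ≡ suc (rank′ l p (rotate x) * n + proj₁ (rotate x))
    rotate-code p p<n (suc v , e) b = trans (cong (λ r → r * n + suc v) (rotate-rank p p<n (suc v , e) b)) (+-suc _ v)
    rotate-code p p<n (zero , e) b = trans (cong (λ r → r * n + 0) (rotate-rank p p<n (zero , e) b))
      (arith n′ (rank′ l p (n′ , sucᶜ e)))
      where
      arith : ∀ n′ r → suc r * suc n′ + 0 ≡ suc (r * suc n′ + n′)
      arith = solve-∀

    rank-≤l : ∀ p x → rank l p x ≤ l
    rank-≤l p (v , suc e) = m∸n≤m l (suc e)
    rank-≤l p (v , zero) with p <ᵇ v
    ... | true = z≤n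
    ... | false = ≤-refl

    ∸-suc-+ : ∀ b {r} → b + r ≤ l → l ∸ r ≡ b + (l ∸ (b + r))
    ∸-suc-+ b {r} le = sym (trans (sym (+-∸-assoc b le)) ([m+n]∸[m+o]≡n∸o b l r))

    rotate-codes : ∀ {w} → length w ≤ n → All (Bounded l′ n) w → codes (rank l) n w ≡ map suc (codes (rank′ l) n (map rotate w))
    rotate-codes {[]} _ _ = refl
    rotate-codes {x ∷ w} le (b ∷ bs) = cong₂ _∷_
      (trans (rotate-code (length w) le x b) (cong (λ p → suc (rank′ l p (rotate x) * n + _)) (sym (length-map rotate w))))
      (rotate-codes (<⇒≤ le) bs)

    rotate-weights : ∀ {w} → length w ≤ n → All (Bounded l′ n) w →
      weights l (rank′ l) (map rotate w) ≡ ∑ w (λ x → 𝟙 (proj₁ x ≡ᵇ 0)) + weights l (rank l) w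
    rotate-weights {[]} _ _ = refl
    rotate-weights {x ∷ w} le (b ∷ bs) = trans
      (cong₂ _+_ (trans (cong (λ p → l ∸ rank′ l p (rotate x)) (length-map rotate w)) head) (rotate-weights (<⇒≤ le) bs))
      (interchange z (l ∸ rank l (length w) x) _ _)
      where
      z = 𝟙 (proj₁ x ≡ᵇ 0)
      e = rotate-rank (length w) le x b
      head : l ∸ rank′ l (length w) (rotate x) ≡ z + (l ∸ rank l (length w) x)
      head = trans (∸-suc-+ z (subst (_≤ l) e (rank-≤l (length w) x))) (cong (λ r → z + (l ∸ r)) (sym e))

    ∑-zeros : ∀ {w} → ColouredPerm l n w → ∑ w (λ x → 𝟙 (proj₁ x ≡ᵇ 0)) ≡ 1
    ∑-zeros {w} (colouredPerm len bd u) = trans (sym (∑-map proj₁ w)) (trans (∑-↭ values) (cong suc (no-zeros n′)))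
      where
      values : map proj₁ w ↭ upTo n
      values = unique-⊆⇒↭ u (λ p → let x , q , e = ∈-map⁻ proj₁ p in ∈-upTo⁺ (subst (_< n) (sym e) (proj₁ (All.lookup bd q))))
        (≤-reflexive (trans (length-upTo n) (sym (trans (length-map proj₁ w) len))))
      no-zeros : ∀ k → ∑ (applyUpTo suc k) (λ v → 𝟙 (v ≡ᵇ 0)) ≡ 0
      no-zeros k = go k suc (λ _ → 1+n≢0)
        where
        go : ∀ k (f : ℕ → ℕ) → (∀ i → f i ≢ 0) → ∑ (applyUpTo f k) (λ v → 𝟙 (v ≡ᵇ 0)) ≡ 0
        go zero f ne = refl
        go (suc k) f ne rewrite ≡ᵇ-false (ne 0) = go k (f ∘ suc) (ne ∘ suc)

  rotate-perm : ∀ {w} → ColouredPerm l n w → ColouredPerm l n (map rotate w)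
  rotate-perm {w} (colouredPerm len bd u) = colouredPerm (trans (length-map rotate w) len)
    (AllP.map⁺ (All.map rotate-bounded bd))
    (subst Unique (trans (sym (map-∘ w)) (trans (map-cong (sym ∘ proj₁-rotate) w) (map-∘ w)))
      (unique-map-∈ predᶜ (λ p q → predᶜ-injective (bound p) (bound q)) u))
    where
    bound : ∀ {v} → v ∈ map proj₁ w → v < n
    bound p = let x , q , e = ∈-map⁻ proj₁ p in subst (_< n) (sym e) (proj₁ (All.lookup bd q))

  rotate-tStat : ∀ {w} → ColouredPerm l n w →
    tStatᵐ l (map rotate w) + l * fixedPoints (map rotate w) ≡ suc (tStatᵐ l w)
  rotate-tStat {w} cp@(colouredPerm len bd u) = begin
    tStatᵐ l (map rotate w) + l * fixedPoints (map rotate w) ≡⟨ weights-rank′ l (map rotate w) ⟨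
    weights l (rank′ l) (map rotate w)                       ≡⟨ rotate-weights (≤-reflexive len) bd ⟩
    ∑ w (λ x → 𝟙 (proj₁ x ≡ᵇ 0)) + weights l (rank l) w     ≡⟨ cong₂ _+_ (∑-zeros cp) (weights-rank l w) ⟩
    suc (tStatᵐ l w) ∎
    where open ≡-Reasoning

  rotate-qStat : ∀ {w} → ColouredPerm l n w → qStatᵐ false l (map rotate w) ≡ qStatᵐ true l w
  rotate-qStat {w} cp@(colouredPerm len bd u) with colouredPerm _ bd′ u′ ← rotate-perm cp = begin
    qStatᵐ false l (map rotate w)                          ≡⟨ majBy-codes-rank′ l′ n bd′ u′ ⟨
    majBy gtℕ (codes (rank′ l) n (map rotate w))           ≡⟨ majBy-map suc (λ _ _ → refl) (codes (rank′ l) n (map rotate w)) ⟨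
    majBy gtℕ (map suc (codes (rank′ l) n (map rotate w))) ≡⟨ cong (majBy gtℕ) (rotate-codes (≤-reflexive len) bd) ⟨
    majBy gtℕ (codes (rank l) n w)                         ≡⟨ majBy-codes-rank l′ n bd u ⟩
    qStatᵐ true l w ∎
    where open ≡-Reasoning

  rotate-↭ : ∀ {xs} → Unique xs → (∀ {w} → w ∈ xs → ColouredPerm l n w) → (∀ {w} → ColouredPerm l n w → w ∈ xs) →
    map (map rotate) xs ↭ xs
  rotate-↭ {xs} u sound complete = unique-⊆⇒↭
    (unique-map-∈ (map rotate) (λ p q → map-rotate-injective (bounded (sound p)) (bounded (sound q))) u)
    (λ p → let w , q , e = ∈-map⁻ (map rotate) p in subst (_∈ xs) (sym e) (complete (rotate-perm (sound q))))
    (≤-reflexive (sym (length-map (map rotate) xs)))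
    where
    map-rotate-injective : ∀ {w w′} → All (Bounded l′ n) w → All (Bounded l′ n) w′ → map rotate w ≡ map rotate w′ → w ≡ w′
    map-rotate-injective {[]} {[]} _ _ _ = refl
    map-rotate-injective {x ∷ w} {x′ ∷ w′} (b ∷ bs) (b′ ∷ bs′) e with e₁ , e₂ ← ∷-injective e =
      cong₂ _∷_ (rotate-injective b b′ e₁) (map-rotate-injective bs bs′ e₂)

module _ (l′ : ℕ) (P : ℕ → List (List (ℕ × ℕ))) (P-unique : ∀ n → Unique (P n))
  (P-sound : ∀ {n w} → w ∈ P n → ColouredPerm (suc l′) n w)
  (P-complete : ∀ {n w} → ColouredPerm (suc l′) n w → w ∈ P n) where

  private
    l = suc l′

  D : ℕ → List (List (ℕ × ℕ))
  D = derangements z<s P P-unique P-sound P-complete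

  ∑-P′ : ∀ s n (φ : ℕ → Test) →
    ∑ (P n) (λ w → φ (fixedPoints w) (tStatᵐ l w) (qStatᵐ s l w))
    ≡ ∑ (antidiagonal n) (λ (k , j) → gaussian (tStat l) (qStat l) D (k , j) (φ j))
  ∑-P′ = ∑-P z<s P P-unique P-sound P-complete

  rotation : ∀ n (φ : Test) → total (tStat l) (qStat l) D (suc n) (φ ∘ suc)
    ≡ ∑ (antidiagonal (suc n)) (λ (k , j) → gaussian (tStat l) (qStat l) D (k , j) (λ t → φ (t + l * j)))
  rotation n φ = begin
    total (tStat l) (qStat l) D (suc n) (φ ∘ suc)
      ≡⟨ ∑-P′ true (suc n) (λ _ → φ ∘ suc) ⟨
    ∑ (P (suc n)) (λ w → φ (suc (tStatᵐ l w)) (qStatᵐ true l w))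
      ≡⟨ ∑-cong∈ (P (suc n)) (λ p → let cp = P-sound p in cong₂ φ (sym (rotate-tStat l′ n cp)) (sym (rotate-qStat l′ n cp))) ⟩
    ∑ (P (suc n)) (Φ ∘ map (rotate l′ n))
      ≡⟨ ∑-map (map (rotate l′ n)) (P (suc n)) ⟨
    ∑ (map (map (rotate l′ n)) (P (suc n))) Φ
      ≡⟨ ∑-↭ (rotate-↭ l′ n (P-unique (suc n)) P-sound P-complete) ⟩
    ∑ (P (suc n)) Φ
      ≡⟨ ∑-P′ false (suc n) (λ j t → φ (t + l * j)) ⟩
    _ ∎
    where
    open ≡-Reasoning
    Φ : List (ℕ × ℕ) → ℕ
    Φ w = φ (tStatᵐ l w + l * fixedPoints w) (qStatᵐ false l w)

  D-zero : ∀ φ → ∑ (D 0) (λ w → φ (tStat l w) (qStat l w)) ≡ φ 0 0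
  D-zero φ = begin
    ∑ (D 0) (λ w → φ (tStat l w) (qStat l w))        ≡⟨ gaussian-0 (tStat l) (qStat l) D 0 φ ⟨
    gaussian (tStat l) (qStat l) D (0 , 0) φ         ≡⟨ +-identityʳ _ ⟨
    total (tStat l) (qStat l) D 0 φ                  ≡⟨ ∑-P′ true 0 (λ _ → φ) ⟨
    ∑ (P 0) (λ w → φ (tStatᵐ l w) (qStatᵐ true l w)) ≡⟨ ∑-↭ P₀ ⟩
    φ 0 0 + 0                                        ≡⟨ +-identityʳ _ ⟩
    φ 0 0 ∎
    where
    open ≡-Reasoning
    P₀ : P 0 ↭ [] ∷ []
    P₀ = unique-⊆⊇⇒↭ (P-unique 0) ([] ∷ []) (λ {w} p → empty w (length≡ (P-sound p)))
      (λ { (here refl) → P-complete (colouredPerm refl [] []) })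
      where
      empty : ∀ w → length w ≡ 0 → w ∈ [] ∷ []
      empty [] _ = here refl

  -- At most the pair with `j′ = j` passes the test, and there k = n - j. What is left is a Gaussian
  -- binomial times D_k, and the binomial, being free of t, does not move the centre.
  fixed-su : ∀ j n ψ → SymmetricUnimodal (l * (n ∸ j))
    (λ i → ∑ (P n) (λ w → if fixedPoints w ≡ᵇ j then δ i ψ (tStatᵐ l w) (qStatᵐ true l w) else 0))
  fixed-su j n ψ = su-cong (λ i → sym (∑-P′ true n (test i))) (su-∑ (antidiagonal n) λ {(k , j′)} p → term k j′ p (j′ ≟ j))
    where
    test : ℕ → ℕ → Test
    test i j′ t q = if j′ ≡ᵇ j then δ i ψ t q else 0
    term : ∀ k j′ → (k , j′) ∈ antidiagonal n → Dec (j′ ≡ j) →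
      SymmetricUnimodal (l * (n ∸ j)) (λ i → gaussian (tStat l) (qStat l) D (k , j′) (test i j′))
    term k j′ p (no ne) rewrite ≡ᵇ-false ne = su-cong (λ i → sym (gaussian-zero (tStat l) (qStat l) D (k , j′))) su-zero
    term k j′ p (yes refl) rewrite ≡ᵇ-true {j′} refl = su-centre
      (cong (l *_) (trans (sym (m+n∸n≡m k j′)) (cong (_∸ j′) (∈-antidiagonal n p))))
      (su-gaussian (tStat l) (qStat l) D (l * k) k j′ (su-D (tStat l) (qStat l) D l′ rotation D-zero k) ψ)

  all-su : ∀ n ψ → SymmetricUnimodal (l * suc n ∸ 1)
    (λ i → ∑ (P (suc n)) (λ w → δ i ψ (tStatᵐ l w) (qStatᵐ true l w)))
  all-su n ψ = su-cong (λ i → sym (∑-P′ true (suc n) (λ _ → δ i ψ)))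
    (total-su (tStat l) (qStat l) D l′ rotation D-zero n ψ)

  all-positive : ∀ n φ → φ 0 0 ≤ ∑ (P n) (λ w → φ (tStatᵐ l w) (qStatᵐ true l w))
  all-positive n φ = subst (φ 0 0 ≤_) (sym (∑-P′ true n (λ _ → φ)))
    (total-positive (tStat l) (qStat l) D D-zero n φ)

-- Comparison with the statistics on ColPerms

words-unique : ∀ n l k → Unique (words n l k)
words-unique n l zero = [] ∷ []
words-unique n l (suc k) = unique-concatMap _ Vec.head (Uniq.cartesianProduct⁺ (Uniq.allFin⁺ n) (Uniq.allFin⁺ l))
  (λ _ → Uniq.map⁺ (λ { refl → refl }) (words-unique n l k))
  (λ {a} _ p → let w , _ , e = ∈-map⁻ (a ∷ᵥ_) p in cong Vec.head e)

∈-words : ∀ {n l k} (w : Vec (Letter n l) k) → w ∈ words n l k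
∈-words []ᵥ = here refl
∈-words {n} {l} ((v , e) ∷ᵥ w) = ∈-concatMap⁺ _ (lose (∈-cartesianProduct⁺ (∈-allFin v) (∈-allFin e)) (∈-map⁺ _ (∈-words w)))

memᵇ⇒∈ : ∀ x ys → memᵇ x ys ≡ true → x ∈ ys
memᵇ⇒∈ x (y ∷ ys) e with x ≡ᵇ y in q
... | true = here (≡ᵇ⇒≡′ x y q)
... | false = there (memᵇ⇒∈ x ys e)

∈⇒memᵇ : ∀ {x ys} → x ∈ ys → memᵇ x ys ≡ true
∈⇒memᵇ {x} (here refl) rewrite ≡ᵇ-true {x} refl = refl
∈⇒memᵇ {x} (there p) rewrite ∈⇒memᵇ p = ∨-zeroʳ _

distinctᵇ⇒Unique : ∀ xs → T (distinctᵇ xs) → Unique xs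
distinctᵇ⇒Unique [] _ = []
distinctᵇ⇒Unique (x ∷ xs) d with memᵇ x xs in e
... | false = AllP.¬Any⇒All¬ xs (λ p → case (trans (sym (∈⇒memᵇ p)) e)) ∷ distinctᵇ⇒Unique xs d
  where
  case : ¬ (true ≡ false)
  case ()

Unique⇒distinctᵇ : ∀ {xs} → Unique xs → T (distinctᵇ xs)
Unique⇒distinctᵇ [] = _
Unique⇒distinctᵇ {x ∷ xs} (x∉ ∷ u) with memᵇ x xs in e
... | false = Unique⇒distinctᵇ u
... | true = contradiction (memᵇ⇒∈ x xs e) (AllP.All¬⇒¬Any x∉)

letter : ∀ {n l} → Letter n l → ℕ × ℕ
letter (v , e) = toℕ v , toℕ e

letter-injective : ∀ {n l} {a b : Letter n l} → letter a ≡ letter b → a ≡ b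
letter-injective e = cong₂ _,_ (toℕ-injective (cong proj₁ e)) (toℕ-injective (cong proj₂ e))

word : ∀ {n l k} → Vec (Letter n l) k → List (ℕ × ℕ)
word w = reverse (map letter (toList w))

toList-injective : ∀ {A : Set} {k} {v w : Vec A k} → toList v ≡ toList w → v ≡ w
toList-injective {v = []ᵥ} {[]ᵥ} _ = refl
toList-injective {v = x ∷ᵥ v} {y ∷ᵥ w} e with refl , e′ ← ∷-injective e = cong (x ∷ᵥ_) (toList-injective e′)

word-injective : ∀ {n l k} {v w : Vec (Letter n l) k} → word v ≡ word w → v ≡ w
word-injective e = toList-injective (map-injective letter-injective (reverse-injective e))

length-toList : ∀ {A : Set} {k} (w : Vec A k) → length (toList w) ≡ k
length-toList []ᵥ = refl
length-toList (x ∷ᵥ w) = cong suc (length-toList w)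

letters-preimage : ∀ {n l k} xs → length xs ≡ k → All (λ (v , e) → v < n × e < l) xs →
  ∃ λ (w : Vec (Letter n l) k) → map letter (toList w) ≡ xs
letters-preimage [] refl [] = []ᵥ , refl
letters-preimage (_ ∷ xs) refl ((v< , e<) ∷ bd) with w , eq ← letters-preimage xs refl bd =
  (fromℕ< v< , fromℕ< e<) ∷ᵥ w , cong₂ _∷_ (cong₂ _,_ (toℕ-fromℕ< v<) (toℕ-fromℕ< e<)) eq

perms : ℕ → ℕ → List (List (ℕ × ℕ))
perms l n = map word (ColPerms l n)

perms-unique : ∀ l n → Unique (perms l n)
perms-unique l n = Uniq.map⁺ word-injective (Uniq.filter⁺ (T? ∘ isColPerm) (words-unique n l n))

private
  values : ∀ {n l k} → Vec (Letter n l) k → List ℕ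
  values w = map (λ a → toℕ (proj₁ a)) (toList w)

  values-word : ∀ {n l k} (w : Vec (Letter n l) k) → map proj₁ (word w) ↭ values w
  values-word w = subst (map proj₁ (word w) ↭_) (sym (map-∘ (toList w)))
    (Perm.map⁺ proj₁ (Perm.↭-reverse (map letter (toList w))))

perms-sound : ∀ {l n w} → w ∈ perms l n → ColouredPerm l n w
perms-sound {l} {n} p with w , q , refl ← ∈-map⁻ word p = colouredPerm
  (trans (length-reverse (map letter (toList w))) (trans (length-map letter (toList w)) (length-toList w)))
  (Perm.All-resp-↭ (↭-sym (Perm.↭-reverse _)) (AllP.map⁺ (All.universal (λ (v , e) → toℕ<n v , toℕ<n e) (toList w))))
  (Unique-resp-↭ (↭-sym (values-word w)) (distinctᵇ⇒Unique _ (proj₂ (∈-filter⁻ (T? ∘ isColPerm) {xs = words n l n} q))))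

perms-complete : ∀ {l n w} → ColouredPerm l n w → w ∈ perms l n
perms-complete {l} {n} {w} (colouredPerm len bd u)
  with v , e ← letters-preimage {n} {l} {n} (reverse w) (trans (length-reverse w) len) (Perm.All-resp-↭ (↭-sym (Perm.↭-reverse w)) bd) =
  subst (_∈ perms l n) word-v (∈-map⁺ word (∈-filter⁺ (T? ∘ isColPerm) (∈-words v)
    (Unique⇒distinctᵇ (Unique-resp-↭ (values-word v) (subst (Unique ∘ map proj₁) (sym word-v) u)))))
  where
  word-v : word v ≡ w
  word-v = trans (cong reverse e) (reverse-involutive w)

module _ {l n : ℕ} where

  code : ℕ × ℕ → ℕ
  code (v , e) = (l ∸ 1 ∸ e) * n + v

  exceeds : ℕ → ℕ × ℕ → Bool
  exceeds p x = (l ∸ 1) * n + p <ᵇ code x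

  excedances : List (ℕ × ℕ) → ℕ
  excedances [] = 0
  excedances (x ∷ w) = 𝟙 (exceeds (length w) x) + excedances w

  majˡ : List (ℕ × ℕ) → ℕ
  majˡ = majBy (λ y x → code x <ᵇ code y)

  -- The accumulator u is the reversed prefix already read.
  excAux-ʳ++ : ∀ (xs : List (Letter n l)) u →
    excedances (map letter xs ʳ++ u) ≡ excedances u + excAux (length u) xs
  excAux-ʳ++ [] u = sym (+-identityʳ _)
  excAux-ʳ++ (x ∷ xs) u = trans (excAux-ʳ++ xs (letter x ∷ u))
    (xy∙z≈y∙xz (𝟙 (exceeds (length u) (letter x))) (excedances u) (excAux (suc (length u)) xs))

  fixAux-ʳ++ : ∀ (xs : List (Letter n l)) u →
    fixedPoints (map letter xs ʳ++ u) ≡ fixedPoints u + fixAux (length u) xs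
  fixAux-ʳ++ [] u = sym (+-identityʳ _)
  fixAux-ʳ++ (x ∷ xs) u = trans (fixAux-ʳ++ xs (letter x ∷ u)) (trans (cong (_+ fixAux (suc (length u)) xs) fixedPoints-∷)
    (xy∙z≈y∙xz (𝟙 (isFixed (length u) (letter x))) (fixedPoints u) (fixAux (suc (length u)) xs)))
    where
    fixedPoints-∷ : fixedPoints (letter x ∷ u) ≡ 𝟙 (isFixed (length u) (letter x)) + fixedPoints u
    fixedPoints-∷ with isFixed (length u) (letter x)
    ... | true = refl
    ... | false = refl

  colorSum-ʳ++ : ∀ (xs : List (Letter n l)) u → ∑ (map letter xs ʳ++ u) proj₂ ≡ ∑ u proj₂ + colorSum xs
  colorSum-ʳ++ [] u = sym (+-identityʳ _)
  colorSum-ʳ++ (x ∷ xs) u = trans (colorSum-ʳ++ xs (letter x ∷ u)) (xy∙z≈y∙xz (toℕ (proj₂ x)) (∑ u proj₂) (colorSum xs))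

  desSum-ʳ++ : ∀ x (xs : List (Letter n l)) u →
    majˡ (map letter xs ʳ++ (letter x ∷ u)) ≡ majˡ (letter x ∷ u) + desSum (suc (length u)) (x ∷ xs)
  desSum-ʳ++ x [] u = sym (+-identityʳ _)
  desSum-ʳ++ x (y ∷ xs) u = trans (desSum-ʳ++ y xs (letter x ∷ u))
    (xy∙z≈y∙xz (if code (letter y) <ᵇ code (letter x) then suc (length u) else 0) (majˡ (letter x ∷ u)) (desSum (2 + length u) (y ∷ xs)))

  desSum-word : ∀ (xs : List (Letter n l)) → majˡ (reverse (map letter xs)) ≡ desSum 1 xs
  desSum-word [] = refl
  desSum-word (x ∷ xs) = desSum-ʳ++ x xs []

-- Trading the excedance count for ranks

module _ (l′ n : ℕ) where

  private
    l = suc l′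

    κ : ℕ × ℕ → ℕ
    κ = code {l} {n}

    exceeds′ : ℕ → ℕ × ℕ → Bool
    exceeds′ = exceeds {l} {n}

    excedances′ majˡ′ : List (ℕ × ℕ) → ℕ
    excedances′ = excedances {l} {n}
    majˡ′ = majˡ {l} {n}

    κ̂ : ℕ → ℕ × ℕ → ℕ
    κ̂ p x = rank l p x * n + proj₁ x

    -- On letters that are not excedances the two orders agree up to a translation by `n`, which
    -- makes room at the bottom for the excedances coming from the top. `κ-<` puts such a letter
    -- below a neighbouring excedance in the colour order.
    record NotExceeding (p : ℕ) (x : ℕ × ℕ) : Set where
      constructor notExceeding
      field
        exceeds-false : exceeds′ p x ≡ false
        κ̂≡ : κ̂ p x ≡ n + κ x
        κ-< : ∀ {v} → v ≢ proj₁ x → p ≤ v → κ x < l′ * n + v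
        colour≡ : proj₂ x ≡ l ∸ rank l p x

    open NotExceeding

    data Class (p : ℕ) : ℕ × ℕ → Set where
      exceeding : ∀ {v} → p < v → Class p (v , 0)
      other : ∀ {x} → NotExceeding p x → Class p x

    exceeds-true : ∀ {p v} → p < v → exceeds′ p (v , 0) ≡ true
    exceeds-true {p} {v} p<v = trans (+-<ᵇ (l′ * n) p v) (<ᵇ-true p<v)

    classify : ∀ p x → Bounded l′ n x → Class p x
    classify p (v , zero) _ with p <? v
    ... | yes p<v = exceeding p<v
    ... | no p≮v = other (notExceeding
      (trans (+-<ᵇ (l′ * n) p v) (<ᵇ-false v≤p))
      (trans (cong (λ r → r * n + v) r≡) (+-assoc n (l′ * n) v))
      (λ v′≢v p≤v′ → +-monoʳ-< (l′ * n) (≤∧≢⇒< (≤-trans v≤p p≤v′) (v′≢v ∘ sym)))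
      (sym (trans (cong (l ∸_) r≡) (n∸n≡0 l))))
      where
      v≤p = ≮⇒≥ p≮v
      r≡ : rank l p (v , 0) ≡ l
      r≡ = rank-≤ l v≤p
    classify p (v , suc e) (v<n , s≤s e<l′) = other (notExceeding
      (<ᵇ-false (<⇒≤ (block-< p v<n r<l′)))
      (trans (cong (λ r → r * n + v) r≡) (+-assoc n ((l′ ∸ suc e) * n) v))
      (λ {v′} _ _ → block-< v′ v<n r<l′)
      (sym (m∸[m∸n]≡n (m≤n⇒m≤1+n e<l′))))
      where
      r≡ : l′ ∸ e ≡ suc (l′ ∸ suc e)
      r≡ = +-∸-assoc 1 e<l′
      r<l′ : l′ ∸ suc e < l′
      r<l′ = subst (_≤ l′) r≡ (m∸n≤m l′ e)

    -- The local form of the run argument. Entering a run of excedances creates a descent in the new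
    -- order, leaving it removes one from the old order, and each step inside the run raises the
    -- open position by 1, matched by one more excedance.
    adjacent : ∀ p {x y} → proj₁ x ≢ proj₁ y → Bounded l′ n x → Bounded l′ n y →
      (if κ x <ᵇ κ y then suc p else 0) + (if exceeds′ (suc p) x then suc (suc p) else 0)
      ≡ (if κ̂ (suc p) x <ᵇ κ̂ p y then suc p else 0) + 𝟙 (exceeds′ (suc p) x) + (if exceeds′ p y then suc p else 0)
    adjacent p {x} {y} x≢y bx by with classify (suc p) x bx | classify p y by
    ... | exceeding {v} lt | exceeding {v′} lt′
      rewrite exceeds-true lt | exceeds-true lt′ | rank-> l lt | rank-> l lt′ | +-<ᵇ (l′ * n) v v′ =
      trans (+-suc d (suc p)) (sym (cong (_+ suc p) (+-comm d 1)))
      where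
      d = if v <ᵇ v′ then suc p else 0
    ... | exceeding {v} lt | other o
      rewrite exceeds-true lt | exceeds-false o | rank-> l lt | κ̂≡ o
        | <ᵇ-false (<⇒≤ (κ-< o x≢y (≤-trans (n≤1+n p) (<⇒≤ lt)))) | <ᵇ-true (≤-trans (proj₁ bx) (m≤m+n n (κ y))) =
      sym (trans (+-identityʳ _) (+-comm (suc p) 1))
    ... | other o | exceeding {v} lt
      rewrite exceeds-true lt | exceeds-false o | rank-> l lt | κ̂≡ o
        | <ᵇ-true (κ-< o (x≢y ∘ sym) lt) | <ᵇ-false (≤-trans (<⇒≤ (proj₁ by)) (m≤m+n n (κ x))) = +-identityʳ _
    ... | other o | other o′
      rewrite exceeds-false o | exceeds-false o′ | κ̂≡ o | κ̂≡ o′ | +-<ᵇ n (κ x) (κ y) = sym (+-identityʳ _)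

    -- Contribution of the run of excedances, if any, at the end of the word.
    openRun : List (ℕ × ℕ) → ℕ
    openRun [] = 0
    openRun (x ∷ w) = if exceeds′ (length w) x then suc (length w) else 0

    maj-run : ∀ {w} → All (Bounded l′ n) w → Unique (map proj₁ w) →
      majˡ′ w + openRun w ≡ majBy gtℕ (codes (rank l) n w) + excedances′ w
    maj-run {[]} _ _ = refl
    maj-run {x ∷ []} (bx ∷ []) _ with exceeds′ 0 x
    ... | true = refl
    ... | false = refl
    maj-run {x ∷ y ∷ w} (bx ∷ by ∷ bw) ((x≢y ∷ _) ∷ u) = begin
      a + majˡ′ (y ∷ w) + openRun (x ∷ y ∷ w)
        ≡⟨ arith₁ a (majˡ′ (y ∷ w)) (openRun (x ∷ y ∷ w)) ⟩
      a + openRun (x ∷ y ∷ w) + majˡ′ (y ∷ w)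
        ≡⟨ cong (_+ majˡ′ (y ∷ w)) (adjacent (length w) x≢y bx by) ⟩
      b + c + openRun (y ∷ w) + majˡ′ (y ∷ w)
        ≡⟨ arith₂ b c (openRun (y ∷ w)) (majˡ′ (y ∷ w)) ⟩
      b + c + (majˡ′ (y ∷ w) + openRun (y ∷ w))
        ≡⟨ cong (b + c +_) (maj-run (by ∷ bw) u) ⟩
      b + c + (majBy gtℕ (codes (rank l) n (y ∷ w)) + excedances′ (y ∷ w))
        ≡⟨ interchange b c _ _ ⟩
      b + majBy gtℕ (codes (rank l) n (y ∷ w)) + (c + excedances′ (y ∷ w))
        ≡⟨ cong (λ i → (if κ̂ (suc (length w)) x <ᵇ κ̂ (length w) y then suc i else 0) + majBy gtℕ (codes (rank l) n (y ∷ w)) + (c + excedances′ (y ∷ w)))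
             (length-codes (rank l) n w) ⟨
      majBy gtℕ (codes (rank l) n (x ∷ y ∷ w)) + excedances′ (x ∷ y ∷ w) ∎
      where
      open ≡-Reasoning
      a = if κ x <ᵇ κ y then suc (length w) else 0
      b = if κ̂ (suc (length w)) x <ᵇ κ̂ (length w) y then suc (length w) else 0
      c = 𝟙 (exceeds′ (suc (length w)) x)
      arith₁ : ∀ a m r → a + m + r ≡ a + r + m
      arith₁ = solve-∀
      arith₂ : ∀ b c r m → b + c + r + m ≡ b + c + (m + r)
      arith₂ = solve-∀

    -- No run of excedances reaches the end of the word: at the last position there is no larger
    -- value.
    openRun-perm : ∀ {w} → ColouredPerm l n w → openRun w ≡ 0
    openRun-perm {[]} _ = refl
    openRun-perm {x ∷ w} (colouredPerm refl (bx ∷ _) _) with classify (length w) x bx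
    ... | exceeding lt = contradiction (proj₁ bx) (≤⇒≯ lt)
    ... | other o rewrite exceeds-false o = refl

  maj-perm : ∀ {w} → ColouredPerm l n w → majˡ {l} {n} w ≡ qStatᵐ true l w + excedances {l} {n} w
  maj-perm {w} cp@(colouredPerm _ bd u) = begin
    majˡ′ w                                               ≡⟨ +-identityʳ _ ⟨
    majˡ′ w + 0                                           ≡⟨ cong (majˡ′ w +_) (openRun-perm cp) ⟨
    majˡ′ w + openRun w                                   ≡⟨ maj-run bd u ⟩
    majBy gtℕ (codes (rank l) n w) + excedances′ w        ≡⟨ cong (_+ excedances′ w) (majBy-codes-rank l′ n bd u) ⟩
    qStatᵐ true l w + excedances′ w ∎
    where open ≡-Reasoning

  fexc-perm : ∀ {w} → All (Bounded l′ n) w → l * excedances {l} {n} w + ∑ w proj₂ ≡ tStatᵐ l w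
  fexc-perm {w} bd = trans (sum bd) (weights-rank l w)
    where
    head : ∀ p x → Bounded l′ n x → l * 𝟙 (exceeds′ p x) + proj₂ x ≡ l ∸ rank l p x
    head p x bx with classify p x bx
    ... | exceeding lt rewrite exceeds-true lt | rank-> l lt = trans (+-identityʳ _) (*-identityʳ l)
    ... | other o rewrite exceeds-false o | *-zeroʳ l′ = colour≡ o
    sum : ∀ {w} → All (Bounded l′ n) w → l * excedances′ w + ∑ w proj₂ ≡ weights l (rank l) w
    sum {[]} [] = trans (+-identityʳ _) (*-zeroʳ l)
    sum {x ∷ w} (bx ∷ bw) = begin
      l * (c + excedances′ w) + (proj₂ x + ∑ w proj₂)   ≡⟨ arith l c (excedances′ w) (proj₂ x) (∑ w proj₂) ⟩
      l * c + proj₂ x + (l * excedances′ w + ∑ w proj₂) ≡⟨ cong₂ _+_ (head (length w) x bx) (sum bw) ⟩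
      weights l (rank l) (x ∷ w) ∎
      where
      open ≡-Reasoning
      c = 𝟙 (exceeds′ (length w) x)
      arith : ∀ l c s e t → l * (c + s) + (e + t) ≡ l * c + e + (l * s + t)
      arith = solve-∀

  module _ {π : Vec (Letter n l) n} (π∈ : π ∈ ColPerms l n) where

    private
      w = word π
      cp : ColouredPerm l n w
      cp = perms-sound (∈-map⁺ word π∈)

      exc≡ : exc π ≡ excedances′ w
      exc≡ = sym (excAux-ʳ++ (toList π) [])

    fix≡ : fix π ≡ fixedPoints w
    fix≡ = sym (fixAux-ʳ++ (toList π) [])

    fexc≡ : fexc π ≡ tStatᵐ l w
    fexc≡ = trans (cong₂ (λ i s → l * i + s) exc≡ (sym (colorSum-ʳ++ (toList π) []))) (fexc-perm (bounded cp))

    majMinusExc≡ : majMinusExc π ≡ ℤ.+ qStatᵐ true l w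
    majMinusExc≡ = trans (cong₂ _⊖_ (trans (sym (desSum-word (toList π))) (maj-perm cp)) exc≡)
      (trans (ℤP.⊖-≥ (m≤n+m (excedances′ w) _)) (cong ℤ.+_ (m+n∸n≡m _ (excedances′ w))))

    term≡ : ∀ k m → 𝟙 ((fexc π ≡ᵇ k) ∧ ⌊ majMinusExc π ℤP.≟ m ⌋)
      ≡ δ k (λ q → 𝟙 ⌊ ℤ.+ q ℤP.≟ m ⌋) (tStatᵐ l w) (qStatᵐ true l w)
    term≡ k m rewrite fexc≡ | majMinusExc≡ with tStatᵐ l w ≡ᵇ k
    ... | true = refl
    ... | false = refl

    fixTerm≡ : ∀ j k m → 𝟙 ((fix π ≡ᵇ j) ∧ (fexc π ≡ᵇ k) ∧ ⌊ majMinusExc π ℤP.≟ m ⌋)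
      ≡ (if fixedPoints w ≡ᵇ j then δ k (λ q → 𝟙 ⌊ ℤ.+ q ℤP.≟ m ⌋) (tStatᵐ l w) (qStatᵐ true l w) else 0)
    fixTerm≡ j k m rewrite fix≡ with fixedPoints w ≡ᵇ j
    ... | true = term≡ k m
    ... | false = refl

  fixPoly≡ : ∀ j k m → fixPoly l n j k m ≡ ∑ (perms l n)
    (λ w → if fixedPoints w ≡ᵇ j then δ k (λ q → 𝟙 ⌊ ℤ.+ q ℤP.≟ m ⌋) (tStatᵐ l w) (qStatᵐ true l w) else 0)
  fixPoly≡ j k m = trans (length-filterᵇ _ (ColPerms l n))
    (trans (∑-cong∈ (ColPerms l n) (λ p → fixTerm≡ p j k m)) (sym (∑-map word (ColPerms l n))))

  APoly≡ : ∀ k m → APoly l n k m ≡ ∑ (perms l n)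
    (λ w → δ k (λ q → 𝟙 ⌊ ℤ.+ q ℤP.≟ m ⌋) (tStatᵐ l w) (qStatᵐ true l w))
  APoly≡ k m = trans (length-filterᵇ _ (ColPerms l n))
    (trans (∑-cong∈ (ColPerms l n) (λ p → term≡ p k m)) (sym (∑-map word (ColPerms l n))))

theorem4p10 : (l n : ℕ) → 1 ≤ l → 1 ≤ n →
    ((j : ℕ) → j ≤ n → NonZeroT (fixPoly l n j) →
    TSymmetricCenter (fixPoly l n j) (l * (n ∸ j)) × TUnimodal (fixPoly l n j))
    × (TSymmetricCenter (APoly l n) (l * n ∸ 1) × TUnimodal (APoly l n))
theorem4p10 l@(suc l′) n@(suc n′) _ _ =
  (λ j _ nz → tSymmetricCenter (fixPoly l n j) (l * (n ∸ j)) (fix-su j) (fix? j) nz ,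
              tUnimodal (fixPoly l n j) (l * (n ∸ j)) (fix-su j) (fix? j) nz) ,
  tSymmetricCenter (APoly l n) (l * n ∸ 1) A-su A? A≢0 , tUnimodal (APoly l n) (l * n ∸ 1) A-su A? A≢0
  where
  fix-su : ∀ j m → SymmetricUnimodal (l * (n ∸ j)) (λ k → fixPoly l n j k m)
  fix-su j m = su-cong (λ k → sym (fixPoly≡ l′ n j k m))
    (fixed-su l′ (perms l) (perms-unique l) perms-sound perms-complete j n (λ q → 𝟙 ⌊ ℤ.+ q ℤP.≟ m ⌋))
  fix? : ∀ j k → Dec (NonZeroQ (fixPoly l n j k))
  fix? j = nonZeroQ? (λ π → fix π ≡ᵇ j) fexc majMinusExc (ColPerms l n)
  A-su : ∀ m → SymmetricUnimodal (l * n ∸ 1) (λ k → APoly l n k m)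
  A-su m = su-cong (λ k → sym (APoly≡ l′ n k m))
    (all-su l′ (perms l) (perms-unique l) perms-sound perms-complete n′ (λ q → 𝟙 ⌊ ℤ.+ q ℤP.≟ m ⌋))
  A? : ∀ k → Dec (NonZeroQ (APoly l n k))
  A? = nonZeroQ? (λ _ → true) fexc majMinusExc (ColPerms l n)
  A≢0 : NonZeroT (APoly l n)
  -- The witness is the monomial t^0 q^0 of the identity permutation.
  A≢0 = 0 , ℤ.+ 0 , λ z → n≮0 (subst (1 ≤_) (trans (sym (APoly≡ l′ n 0 (ℤ.+ 0))) z)
    (all-positive l′ (perms l) (perms-unique l) perms-sound perms-complete n (δ 0 (λ q → 𝟙 ⌊ ℤ.+ q ℤP.≟ ℤ.+ 0 ⌋))))
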